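{- Let $n > 1$ be an integer and $p$ a prime such that $n$ is not a power of $p$. Then $$\sum_{\nu \geq 1} \left\{\frac{n^k}{p^\nu}\right\} \to \infty \quad \text{as } k \to \infty.$$
   Context: $\{x\} = x - \lfloor x \rfloor$ denotes the fractional part. -}

module Defs where

open import Data.Nat using (ℕ; zero; suc; _^_)
open import Data.Nat.Properties using (m^n≢0)
open import Data.Nat.Primality using (Prime; prime⇒nonZero)
open import Data.Integer using (+_)
open import Data.Rational using (ℚ; 0ℚ; _+_; _-_; _/_; floor)

frac : ℚ → ℚ
frac x = x - (floor x / 1)

term : (n p : ℕ) → Prime p → (k ν : ℕ) → ℚ
term n p pp k ν = (+ (n ^ k) / (p ^ ν)) {{m^n≢0 p ν {{prime⇒nonZero pp}}}}

fracTerm : (n p : ℕ) → Prime p → (k ν : ℕ) → ℚ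
fracTerm n p pp k ν = frac (term n p pp k ν)

partialSum : (n p : ℕ) → Prime p → (k V : ℕ) → ℚ
partialSum n p pp k zero = 0ℚ
partialSum n p pp k (suc V) = partialSum n p pp k V + fracTerm n p pp k (suc V)

{-# OPTIONS --safe #-}
module Submission where

-- Write n = p^a m with p ∤ m. It suffices to find, for large k, a nonzero base-p digit of m^k in each of many disjoint
-- windows [k/D′, k/D): such a digit at position ν contributes at least 1/p to the sum, through the term ν + 1.
-- If a window were empty, then m^k ≡ B modulo a high power of p with B small. This is refuted by a p-adic Gelfond
-- argument. Replace m by a power w = m^u ≡ 1 mod q = p^h and B by b = B^u. By the pigeonhole principle there are small
-- integers c_ij, not all zero, such that F(t) = Σ c_ij C(t,i) w^(jt) vanishes modulo q^N for t < N + I; since the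
-- (N+I)-th differences of F vanish modulo q^N, so does F everywhere. At t = r + sk the value F(t) is congruent to
-- Σ c_ij C(t,i) w^(jr) b^(js), which is too small to be a nonzero multiple of q^N. So a nonzero polynomial in (x, y) vanishes
-- at all points (r + sk, w^r b^s) of a large grid, contradicting a zero estimate obtained by eliminating the powers of y
-- one at a time.

open import Defs
open import Data.Empty using (⊥)
open import Data.Fin as Fin using (Fin; toℕ; fromℕ<; finToFun; funToFin; combine)
import Data.Fin.Properties as Fin
open import Data.Integer as ℤ using (ℤ; +_; 0ℤ; 1ℤ; ∣_∣)
open import Data.Integer.DivMod as ℤ using (a≡a%ℕn+[a/ℕn]*n; n%ℕd<d)
open import Data.Integer.Divisibility.Signed
  using (_∣_; divides; ∣⇒∣ᵤ; ∣ᵤ⇒∣; ∣m∣n⇒∣m+n; ∣m∣n⇒∣m-n; ∣n⇒∣m*n; ∣m⇒∣m*n; *-monoʳ-∣; *-monoˡ-∣; ∣-trans)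
import Data.Integer.Properties as ℤ
open import Data.Integer.Tactic.RingSolver using (solve-∀)
open import Data.List using (List; []; _∷_; map; length)
open import Data.List.Properties using (length-map)
open import Data.List.Relation.Unary.All as All using (All; []; _∷_)
import Data.List.Relation.Unary.All.Properties as All
open import Data.List.Relation.Unary.AllPairs using (AllPairs; []; _∷_)
import Data.List.Relation.Unary.AllPairs.Properties as AllPairs
open import Data.Nat
  using (ℕ; zero; suc; _+_; _*_; _∸_; _^_; _!; _≤_; _<_; _<?_; _≤′_; ≤′-refl; ≤′-step; z≤n; s≤s;
         NonZero; >-nonZero; >-nonZero⁻¹; nonTrivial⇒n>1)
open import Data.Nat.Combinatorics using (_C_; nC1≡n; nCk+nC[k+1]≡[n+1]C[k+1]; k>n⇒nCk≡0; nCk≡nC[n∸k]; nCn≡1)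
import Data.Nat.Divisibility as ℕᵈ
open import Data.Nat.DivMod
  using (_/_; _%_; m%n<n; m≡m%n+[m/n]*n; [m+kn]%n≡m%n; m<n⇒m%n≡m; m<n*o⇒m/o<n; m<n⇒m/n≡0; m*n/n≡m;
         +-distrib-/-∣ʳ; m/n*n≤m; /-monoˡ-≤; m≥n⇒m/n>0; m∣n⇒o%n%m≡o%m)
open import Data.Nat.Induction using (<-rec)
open import Data.Nat.Primality using (Prime; euclidsLemma; prime⇒nonZero; prime⇒nonTrivial)
import Data.Nat.Properties as ℕ
open import Data.Nat.Tactic.RingSolver using () renaming (solve-∀ to ℕ-solve-∀)
open import Data.Product using (∃-syntax; _×_; _,_)
open import Data.Rational as ℚ using (ℚ; mkℚ; 0ℚ; floor; toℚᵘ) renaming (_<_ to _<ℚ_)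
import Data.Rational.Properties as ℚ
open import Data.Rational.Unnormalised as ℚᵘ using (mkℚᵘ; *≤*; *<*)
import Data.Rational.Unnormalised.Properties as ℚᵘ
open import Data.Sum as Sum using (_⊎_; inj₁; inj₂)
open import Function using (_∘_)
open import Relation.Binary.PropositionalEquality
open import Relation.Nullary using (¬_; Dec; yes; no; contradiction; ¬?)

-- Integer polynomials with a formal degree and leading coefficient.

-- In Pol d l f the coefficient l of x^d may vanish, so d only bounds the degree.
data Pol : ℕ → ℤ → (ℤ → ℤ) → Set where
  const  : ∀ {l f} → (∀ x → f x ≡ l) → Pol 0 l f
  horner : ∀ {d l f} c {g} → Pol d l g → (∀ x → f x ≡ c ℤ.+ x ℤ.* g x) → Pol (suc d) l f

pol-cong : ∀ {d l f g} → (∀ x → g x ≡ f x) → Pol d l f → Pol d l g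
pol-cong eq (const e)      = const λ x → trans (eq x) (e x)
pol-cong eq (horner c p e) = horner c p λ x → trans (eq x) (e x)

pol-+ : ∀ {d l l′ f g} → Pol d l f → Pol d l′ g → Pol d (l ℤ.+ l′) (λ x → f x ℤ.+ g x)
pol-+ (const e) (const e′) = const λ x → cong₂ ℤ._+_ (e x) (e′ x)
pol-+ (horner c {g} p e) (horner c′ {g′} p′ e′) = horner (c ℤ.+ c′) (pol-+ p p′) λ x →
  trans (cong₂ ℤ._+_ (e x) (e′ x)) (regroup c c′ x (g x) (g′ x))
  where
  regroup : ∀ c c′ x y y′ → (c ℤ.+ x ℤ.* y) ℤ.+ (c′ ℤ.+ x ℤ.* y′) ≡ (c ℤ.+ c′) ℤ.+ x ℤ.* (y ℤ.+ y′)
  regroup = solve-∀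

pol-scale : ∀ {d l f} a → Pol d l f → Pol d (a ℤ.* l) (λ x → a ℤ.* f x)
pol-scale a (const e) = const λ x → cong (a ℤ.*_) (e x)
pol-scale a (horner c {g} p e) = horner (a ℤ.* c) (pol-scale a p) λ x →
  trans (cong (a ℤ.*_) (e x)) (regroup a c x (g x))
  where
  regroup : ∀ a c x y → a ℤ.* (c ℤ.+ x ℤ.* y) ≡ a ℤ.* c ℤ.+ x ℤ.* (a ℤ.* y)
  regroup = solve-∀

-- A degree bound is loosened at the price of a zero formal leading coefficient. This brings two
-- polynomials to the common degree that `pol-+` asks for.
pol-raise : ∀ {d l f} → Pol d l f → Pol (suc d) 0ℤ f
pol-raise {l = l} (const e) = horner l {λ _ → 0ℤ} (const λ _ → refl) λ x →
  trans (e x) (sym (trans (cong (ℤ._+_ l) (ℤ.*-zeroʳ x)) (ℤ.+-identityʳ l)))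
pol-raise (horner c p e) = horner c (pol-raise p) e

pol-raise-by : ∀ n {d l f} → Pol d l f → Pol (suc n + d) 0ℤ f
pol-raise-by zero    p = pol-raise p
pol-raise-by (suc n) p = pol-raise (pol-raise-by n p)

-- In (c + x f′) g = c g + x (f′ g) the first summand is raised to the common degree bound with
-- leading coefficient 0, so the second one alone determines the leading coefficient.
pol-* : ∀ {d e l l′ f g} → Pol d l f → Pol e l′ g → Pol (d + e) (l ℤ.* l′) (λ x → f x ℤ.* g x)
pol-* {l = l} {g = g} (const eq) q = pol-cong (λ x → cong (ℤ._* g x) (eq x)) (pol-scale l q)
pol-* {suc d} {l = l} {l′} {f} {g} (horner c {f′} p eq) q =
  subst (λ l → Pol _ l _) (ℤ.+-identityˡ _)
    (pol-cong (λ x → trans (cong (ℤ._* g x) (eq x)) (regroup c x (f′ x) (g x)))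
      (pol-+ (pol-raise-by d (pol-scale c q))
             (horner 0ℤ (pol-* p q) λ x → sym (ℤ.+-identityˡ _))))
  where
  regroup : ∀ c x y z → (c ℤ.+ x ℤ.* y) ℤ.* z ≡ c ℤ.* z ℤ.+ x ℤ.* (y ℤ.* z)
  regroup = solve-∀

-- Since c + (1 + x) y = (c + x y) + y, the shift only adds a polynomial of lower degree bound, and
-- the leading coefficient stays.
pol-shift : ∀ {d l f} → Pol d l f → Pol d l (λ x → f (1ℤ ℤ.+ x))
pol-shift (const e) = const λ x → e _
pol-shift {l = l} (horner c {g} p e) =
  subst (λ l → Pol _ l _) (ℤ.+-identityʳ l)
    (pol-cong (λ x → trans (e _) (regroup c x (g (1ℤ ℤ.+ x))))
      (pol-+ (horner c (pol-shift p) λ x → refl) (pol-raise (pol-shift p))))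
  where
  regroup : ∀ c x y → c ℤ.+ (1ℤ ℤ.+ x) ℤ.* y ≡ (c ℤ.+ x ℤ.* y) ℤ.+ y
  regroup = solve-∀

-- Division by x - a. The quotient inherits the leading coefficient, so its nonvanishing survives
-- when zeros are split off one after another.
pol-factor : ∀ {d l f} a → Pol (suc d) l f →
  ∃[ g ] Pol d l g × (∀ x → f x ≡ f a ℤ.+ (x ℤ.- a) ℤ.* g x)
pol-factor {zero} {l} {f} a (horner c {g} (const e₀) e) = (λ _ → l) , const (λ _ → refl) , λ x →
  trans (lin x) (trans (regroup c x a l) (cong (ℤ._+ (x ℤ.- a) ℤ.* l) (sym (lin a))))
  where
  lin : ∀ x → f x ≡ c ℤ.+ x ℤ.* l
  lin x = trans (e x) (cong (λ y → c ℤ.+ x ℤ.* y) (e₀ x))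
  regroup : ∀ c x a l → c ℤ.+ x ℤ.* l ≡ (c ℤ.+ a ℤ.* l) ℤ.+ (x ℤ.- a) ℤ.* l
  regroup = solve-∀
pol-factor {suc d} {l} {f} a (horner c {g} p e) with h , ph , eh ← pol-factor a p =
  (λ x → g a ℤ.+ x ℤ.* h x) , horner (g a) ph (λ _ → refl) , λ x → begin
    f x                                                      ≡⟨ e x ⟩
    c ℤ.+ x ℤ.* g x                                          ≡⟨ cong (λ y → c ℤ.+ x ℤ.* y) (eh x) ⟩
    c ℤ.+ x ℤ.* (g a ℤ.+ (x ℤ.- a) ℤ.* h x)                  ≡⟨ regroup c x a (g a) (h x) ⟩
    (c ℤ.+ a ℤ.* g a) ℤ.+ (x ℤ.- a) ℤ.* (g a ℤ.+ x ℤ.* h x)  ≡⟨ cong (ℤ._+ _) (e a) ⟨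
    f a ℤ.+ (x ℤ.- a) ℤ.* (g a ℤ.+ x ℤ.* h x)                ∎
  where
  open ≡-Reasoning
  regroup : ∀ c x a y z → c ℤ.+ x ℤ.* (y ℤ.+ (x ℤ.- a) ℤ.* z) ≡ (c ℤ.+ a ℤ.* y) ℤ.+ (x ℤ.- a) ℤ.* (y ℤ.+ x ℤ.* z)
  regroup = solve-∀

*-≢0 : ∀ {x y} → x ≢ 0ℤ → y ≢ 0ℤ → x ℤ.* y ≢ 0ℤ
*-≢0 {x} x≢0 y≢0 = Sum.[ x≢0 , y≢0 ] ∘ ℤ.i*j≡0⇒i≡0∨j≡0 x

^-≢0 : ∀ {x} n → x ≢ 0ℤ → x ℤ.^ n ≢ 0ℤ
^-≢0 zero    x≢0 = λ ()
^-≢0 (suc n) x≢0 = *-≢0 x≢0 (^-≢0 n x≢0)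

-- Splitting off the zero `z (suc d)` leaves a quotient of degree bound d that still vanishes at the
-- other points, because these are distinct from the one removed.
pol-zeros : ∀ {d l f} → Pol d l f → l ≢ 0ℤ → (z : ℕ → ℤ) →
  (∀ {i j} → i ≤ d → j ≤ d → z i ≡ z j → i ≡ j) → ¬ (∀ {i} → i ≤ d → f (z i) ≡ 0ℤ)
pol-zeros (const e) l≢0 z inj vanish = l≢0 (trans (sym (e (z 0))) (vanish z≤n))
pol-zeros {suc d} {l} {f} p@(horner _ _ _) l≢0 z inj vanish with g , pg , eg ← pol-factor (z (suc d)) p =
  pol-zeros pg l≢0 z (λ i≤d j≤d → inj (ℕ.m≤n⇒m≤1+n i≤d) (ℕ.m≤n⇒m≤1+n j≤d)) vanish′
  where
  a = z (suc d)
  vanish′ : ∀ {i} → i ≤ d → g (z i) ≡ 0ℤ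
  vanish′ {i} i≤d with ℤ.i*j≡0⇒i≡0∨j≡0 (z i ℤ.- a) {g (z i)} (begin
    (z i ℤ.- a) ℤ.* g (z i)           ≡⟨ ℤ.+-identityˡ _ ⟨
    0ℤ ℤ.+ (z i ℤ.- a) ℤ.* g (z i)    ≡⟨ cong (ℤ._+ (z i ℤ.- a) ℤ.* g (z i)) (vanish ℕ.≤-refl) ⟨
    f a ℤ.+ (z i ℤ.- a) ℤ.* g (z i)   ≡⟨ eg (z i) ⟨
    f (z i)                           ≡⟨ vanish (ℕ.m≤n⇒m≤1+n i≤d) ⟩
    0ℤ                                ∎)
    where open ≡-Reasoning
  ... | inj₁ z≡ = contradiction (inj (ℕ.m≤n⇒m≤1+n i≤d) ℕ.≤-refl (ℤ.i-j≡0⇒i≡j (z i) a z≡)) (ℕ.<⇒≢ (s≤s i≤d))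
  ... | inj₂ g≡ = g≡

-- Zero estimate on a grid.

-- The factor ρ clears the denominators of an integer-valued polynomial such as a binomial coefficient.
record PolMultiple (D : ℕ) (φ : ℕ → ℤ) : Set where
  field
    {degree}     : ℕ
    {ρ leading}  : ℤ
    {poly}       : ℤ → ℤ
    degree≤      : degree ≤ D
    ρ≢0          : ρ ≢ 0ℤ
    leading≢0    : leading ≢ 0ℤ
    isPol        : Pol degree leading poly
    multiple     : ∀ x → poly (+ x) ≡ ρ ℤ.* φ x

record Term : Set where
  constructor mkTerm
  field
    ω β : ℤ
    φ   : ℕ → ℤ

-- A term φ(x) y^j is restricted to the points (r + sk, w^r b^s), where y^j becomes ω^r β^s with ω = w^j and β = b^j.
module ZeroEstimate (k : ℕ) where

  open Term

  value : ℕ → ℕ → Term → ℤ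
  value r s (mkTerm ω β φ) = φ (r + s * k) ℤ.* (ω ℤ.^ r ℤ.* β ℤ.^ s)

  eval : ℕ → ℕ → List Term → ℤ
  eval r s []       = 0ℤ
  eval r s (t ∷ ts) = value r s t ℤ.+ eval r s ts

  Good : ℕ → Term → Set
  Good D t = β t ≢ 0ℤ × ω t ≢ 0ℤ × PolMultiple D (φ t)

  -- Passing from r to r + 1 multiplies the exponential part of a term by its ω. The combination of
  -- the values at r and r + 1 with weights φ₀(x+1) ω₀ and -φ₀(x) therefore kills `t₀`, and turns
  -- any other term into a term with the same ω and β.
  eliminate : Term → Term → Term
  eliminate (mkTerm ω₀ _ φ₀) (mkTerm ω β φ) = mkTerm ω β λ x →
    φ₀ (suc x) ℤ.* ω₀ ℤ.* φ x ℤ.- φ₀ x ℤ.* φ (suc x) ℤ.* ω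

  eliminate-value : ∀ r s t₀ t → value r s (eliminate t₀ t) ≡
    φ t₀ (suc (r + s * k)) ℤ.* ω t₀ ℤ.* value r s t ℤ.- φ t₀ (r + s * k) ℤ.* value (suc r) s t
  eliminate-value r s (mkTerm ω₀ _ φ₀) (mkTerm ω β φ) =
    regroup (φ₀ (suc x)) ω₀ (φ x) (φ₀ x) (φ (suc x)) ω (ω ℤ.^ r) (β ℤ.^ s)
    where
    x = r + s * k
    regroup : ∀ φ₀′ ω₀ φ φ₀ φ′ ω u v →
      (φ₀′ ℤ.* ω₀ ℤ.* φ ℤ.- φ₀ ℤ.* φ′ ℤ.* ω) ℤ.* (u ℤ.* v) ≡
      φ₀′ ℤ.* ω₀ ℤ.* (φ ℤ.* (u ℤ.* v)) ℤ.- φ₀ ℤ.* (φ′ ℤ.* ((ω ℤ.* u) ℤ.* v))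
    regroup = solve-∀

  eliminate-eval : ∀ r s t₀ ts → eval r s (map (eliminate t₀) ts) ≡
    φ t₀ (suc (r + s * k)) ℤ.* ω t₀ ℤ.* eval r s ts ℤ.- φ t₀ (r + s * k) ℤ.* eval (suc r) s ts
  eliminate-eval r s t₀ [] = regroup (φ t₀ (suc (r + s * k)) ℤ.* ω t₀) (φ t₀ (r + s * k))
    where
    regroup : ∀ a b → 0ℤ ≡ a ℤ.* 0ℤ ℤ.- b ℤ.* 0ℤ
    regroup = solve-∀
  eliminate-eval r s t₀ (t ∷ ts) =
    trans (cong₂ ℤ._+_ (eliminate-value r s t₀ t) (eliminate-eval r s t₀ ts))
      (regroup (φ t₀ (suc (r + s * k)) ℤ.* ω t₀) (φ t₀ (r + s * k)) _ _ _ _)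
    where
    regroup : ∀ a b x x′ y y′ → (a ℤ.* x ℤ.- b ℤ.* x′) ℤ.+ (a ℤ.* y ℤ.- b ℤ.* y′) ≡
      a ℤ.* (x ℤ.+ y) ℤ.- b ℤ.* (x′ ℤ.+ y′)
    regroup = solve-∀

  -- The image of `t₀` under its own elimination is zero. Hence the sum over the remaining terms
  -- vanishes at (r, s) as soon as the full sum vanishes at (r, s) and (r + 1, s).
  eliminate-head : ∀ r s t₀ ts → eval r s (map (eliminate t₀) ts) ≡
    φ t₀ (suc (r + s * k)) ℤ.* ω t₀ ℤ.* eval r s (t₀ ∷ ts) ℤ.- φ t₀ (r + s * k) ℤ.* eval (suc r) s (t₀ ∷ ts)
  eliminate-head r s t₀ ts = begin
    eval r s (map (eliminate t₀) ts)                             ≡⟨ ℤ.+-identityˡ _ ⟨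
    0ℤ ℤ.+ eval r s (map (eliminate t₀) ts)                      ≡⟨ cong (ℤ._+ eval r s (map (eliminate t₀) ts)) self ⟨
    eval r s (map (eliminate t₀) (t₀ ∷ ts))                      ≡⟨ eliminate-eval r s t₀ (t₀ ∷ ts) ⟩
    _                                                            ∎
    where
    open ≡-Reasoning
    regroup : ∀ φ₀′ ω₀ φ₀ u → (φ₀′ ℤ.* ω₀ ℤ.* φ₀ ℤ.- φ₀ ℤ.* φ₀′ ℤ.* ω₀) ℤ.* u ≡ 0ℤ
    regroup = solve-∀
    self : value r s (eliminate t₀ t₀) ≡ 0ℤ
    self = regroup (φ t₀ (suc (r + s * k))) (ω t₀) (φ t₀ (r + s * k)) _

  -- Shifting does not affect leading coefficients, so the two products combine to the leading
  -- coefficient l₀ l (ω₀ - ω).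
  eliminate-good : ∀ {D} t₀ t → Good D t₀ → Good D t → ω t₀ ≢ ω t → Good (D + D) (eliminate t₀ t)
  eliminate-good (mkTerm ω₀ _ φ₀) (mkTerm ω β φ) (_ , _ , P₀) (β≢0 , ω≢0 , P) ω₀≢ω = β≢0 , ω≢0 , record
    { degree≤   = ℕ.+-mono-≤ P₀.degree≤ P.degree≤
    ; ρ≢0       = *-≢0 P₀.ρ≢0 P.ρ≢0
    ; leading≢0 = λ eq → *-≢0 (*-≢0 P₀.leading≢0 P.leading≢0) (ω₀≢ω ∘ ℤ.i-j≡0⇒i≡j ω₀ ω)
                    (trans (collect P₀.leading P.leading ω₀ ω) eq)
    ; isPol     = pol-+ (pol-scale ω₀ (pol-* (pol-shift P₀.isPol) P.isPol))
                        (pol-scale (ℤ.- ω) (pol-* P₀.isPol (pol-shift P.isPol)))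
    ; multiple  = λ x → trans
        (cong₂ ℤ._+_ (cong (ω₀ ℤ.*_) (cong₂ ℤ._*_ (P₀.multiple (suc x)) (P.multiple x)))
                     (cong (ℤ.- ω ℤ.*_) (cong₂ ℤ._*_ (P₀.multiple x) (P.multiple (suc x)))))
        (regroup ω₀ ω P₀.ρ P.ρ (φ₀ (suc x)) (φ x) (φ₀ x) (φ (suc x)))
    }
    where
    module P₀ = PolMultiple P₀
    module P = PolMultiple P
    collect : ∀ l₀ l ω₀ ω → l₀ ℤ.* l ℤ.* (ω₀ ℤ.- ω) ≡ ω₀ ℤ.* (l₀ ℤ.* l) ℤ.+ ℤ.- ω ℤ.* (l₀ ℤ.* l)
    collect = solve-∀
    regroup : ∀ ω₀ ω ρ₀ ρ a b c d → ω₀ ℤ.* ((ρ₀ ℤ.* a) ℤ.* (ρ ℤ.* b)) ℤ.+ ℤ.- ω ℤ.* ((ρ₀ ℤ.* c) ℤ.* (ρ ℤ.* d)) ≡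
      ρ₀ ℤ.* ρ ℤ.* (a ℤ.* ω₀ ℤ.* b ℤ.- c ℤ.* d ℤ.* ω)
    regroup = solve-∀

  -- The index i enumerates the grid by r = i % R and s = i / R. As r < R ≤ k, division of r + s k
  -- by k recovers r and s.
  grid-injective : ∀ {R} .{{_ : NonZero R}} → R ≤ k → ∀ i j →
    i % R + i / R * k ≡ j % R + j / R * k → i ≡ j
  grid-injective {R} R≤k i j eq = begin
    i                 ≡⟨ m≡m%n+[m/n]*n i R ⟩
    i % R + i / R * R ≡⟨ cong₂ (λ a b → a + b * R) r≡ q≡ ⟩
    j % R + j / R * R ≡⟨ m≡m%n+[m/n]*n j R ⟨
    j                 ∎
    where
    open ≡-Reasoning
    instance
      k≢0 : NonZero k
      k≢0 = >-nonZero (ℕ.<-≤-trans (>-nonZero⁻¹ R) R≤k)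
    digit : ∀ i → (i % R + i / R * k) % k ≡ i % R
    digit i = trans ([m+kn]%n≡m%n (i % R) (i / R) k) (m<n⇒m%n≡m (ℕ.<-≤-trans (m%n<n i R) R≤k))
    r≡ : i % R ≡ j % R
    r≡ = trans (sym (digit i)) (trans (cong (_% k) eq) (digit j))
    q≡ : i / R ≡ j / R
    q≡ = ℕ.*-cancelʳ-≡ _ _ k (ℕ.+-cancelˡ-≡ (i % R) _ _ (trans eq (cong (_+ j / R * k) (sym r≡))))

  -- The factor ω^r β^s is nonzero, so φ itself vanishes at R T > D distinct points.
  single-term : ∀ {D R T} t → Good D t → R ≤ k → D < R * T →
    ¬ (∀ {r s} → r < R → s < T → value r s t ≡ 0ℤ)
  single-term {D} {zero}  t _ _ ()
  single-term {D} {R@(suc _)} {T} (mkTerm ω β φ) (β≢0 , ω≢0 , P) R≤k D<RT vanish =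
    pol-zeros P.isPol P.leading≢0 z (λ {i} {j} _ _ eq → grid-injective R≤k i j (ℤ.+-injective eq)) λ {i} i≤d →
      trans (P.multiple _) (trans (cong (P.ρ ℤ.*_) (φ-vanish i i≤d)) (ℤ.*-zeroʳ P.ρ))
    where
    module P = PolMultiple P
    z : ℕ → ℤ
    z i = + (i % R + i / R * k)
    φ-vanish : ∀ i → i ≤ P.degree → φ (i % R + i / R * k) ≡ 0ℤ
    φ-vanish i i≤d = Sum.[ (λ e → e) , (λ e → contradiction e (*-≢0 (^-≢0 (i % R) ω≢0) (^-≢0 (i / R) β≢0))) ]
      (ℤ.i*j≡0⇒i≡0∨j≡0 (φ (i % R + i / R * k)) (vanish (m%n<n i R)
        (m<n*o⇒m/o<n {n = T} (ℕ.<-≤-trans (ℕ.≤-<-trans (ℕ.≤-trans i≤d P.degree≤) D<RT) (ℕ.≤-reflexive (ℕ.*-comm R T))))))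

  -- Eliminating the first term doubles the degree bound and keeps the leading coefficients nonzero, because the ω are
  -- distinct; after n steps one polynomial of degree at most 2^n D remains, with R T distinct zeros r + sk.
  zero-estimate : ∀ n t ts {D R T} → length ts ≡ n → AllPairs (λ t t′ → ω t ≢ ω t′) (t ∷ ts) → All (Good D) (t ∷ ts) →
    R ≤ k → 2 ^ n * D < R * T → ¬ (∀ {r s} → r < n + R → s < T → eval r s (t ∷ ts) ≡ 0ℤ)
  zero-estimate zero t [] {D} refl _ (good ∷ []) R≤k bound vanish =
    single-term t good R≤k (ℕ.≤-<-trans (ℕ.≤-reflexive (sym (ℕ.*-identityˡ D))) bound)
      λ r<R s<T → trans (sym (ℤ.+-identityʳ _)) (vanish r<R s<T)
  zero-estimate (suc n) t₀ (t ∷ ts) {D} {R} {T} refl (t₀≢ ∷ distinct) (good₀ ∷ good) R≤k bound vanish =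
    zero-estimate n (eliminate t₀ t) (map (eliminate t₀) ts) (length-map (eliminate t₀) ts)
      (AllPairs.map⁺ distinct)
      (All.map⁺ (All.map (λ {t} (≢ω , g) → eliminate-good t₀ t good₀ g ≢ω) (All.zip (t₀≢ , good))))
      R≤k (subst (_< R * T) double bound)
      λ {r} {s} r< s<T → trans (eliminate-head r s t₀ (t ∷ ts))
        (trans (cong₂ (λ a b → φ t₀ (suc (r + s * k)) ℤ.* ω t₀ ℤ.* a ℤ.- φ t₀ (r + s * k) ℤ.* b)
                 (vanish (ℕ.m≤n⇒m≤1+n r<) s<T) (vanish (s≤s r<) s<T))
               (zeros (φ t₀ (suc (r + s * k)) ℤ.* ω t₀) (φ t₀ (r + s * k))))
    where
    double : 2 ^ suc n * D ≡ 2 ^ n * (D + D)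
    double = trans (cong (_* D) (ℕ.*-comm 2 (2 ^ n)))
      (trans (ℕ.*-assoc (2 ^ n) 2 D) (cong (λ e → 2 ^ n * (D + e)) (ℕ.+-identityʳ D)))
    zeros : ∀ a b → a ℤ.* 0ℤ ℤ.- b ℤ.* 0ℤ ≡ 0ℤ
    zeros = solve-∀

-- Finite sums.

∑ : ℕ → (ℕ → ℤ) → ℤ
∑ zero    f = 0ℤ
∑ (suc n) f = ∑ n f ℤ.+ f n

∑-cong : ∀ n {f g} → (∀ {l} → l < n → f l ≡ g l) → ∑ n f ≡ ∑ n g
∑-cong zero    eq = refl
∑-cong (suc n) eq = cong₂ ℤ._+_ (∑-cong n (eq ∘ ℕ.m≤n⇒m≤1+n)) (eq ℕ.≤-refl)

∑-*-distribʳ : ∀ n f a → ∑ n f ℤ.* a ≡ ∑ n (λ l → f l ℤ.* a)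
∑-*-distribʳ zero    f a = refl
∑-*-distribʳ (suc n) f a = trans (ℤ.*-distribʳ-+ a (∑ n f) (f n)) (cong (ℤ._+ f n ℤ.* a) (∑-*-distribʳ n f a))

∑-minus : ∀ n f g → ∑ n f ℤ.- ∑ n g ≡ ∑ n (λ l → f l ℤ.- g l)
∑-minus zero    f g = refl
∑-minus (suc n) f g = trans (regroup (∑ n f) (f n) (∑ n g) (g n)) (cong (ℤ._+ (f n ℤ.- g n)) (∑-minus n f g))
  where
  regroup : ∀ x y x′ y′ → (x ℤ.+ y) ℤ.- (x′ ℤ.+ y′) ≡ (x ℤ.- x′) ℤ.+ (y ℤ.- y′)
  regroup = solve-∀

∑-split : ∀ m n f → ∑ (n + m) f ≡ ∑ m f ℤ.+ ∑ n (λ i → f (i + m))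
∑-split m zero    f = sym (ℤ.+-identityʳ _)
∑-split m (suc n) f = trans (cong (ℤ._+ f (n + m)) (∑-split m n f)) (ℤ.+-assoc (∑ m f) (∑ n λ i → f (i + m)) (f (n + m)))

-- The pair (i, j) is flattened to l = i + j I, so that the unknowns c_ij form one vector in the
-- pigeonhole argument.
∑-blocks : ∀ J I f → ∑ (J * I) f ≡ ∑ J (λ j → ∑ I (λ i → f (i + j * I)))
∑-blocks zero    I f = refl
∑-blocks (suc J) I f = trans (∑-split (J * I) I f) (cong (ℤ._+ ∑ I (λ i → f (i + J * I))) (∑-blocks J I f))

∑-divides : ∀ {q} n {f} → (∀ l → q ∣ f l) → q ∣ ∑ n f
∑-divides zero    q∣f = divides 0ℤ refl
∑-divides (suc n) q∣f = ∣m∣n⇒∣m+n (∑-divides n q∣f) (q∣f n)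

∑-bound : ∀ {b} n {f} → (∀ {l} → l < n → ∣ f l ∣ ≤ b) → ∣ ∑ n f ∣ ≤ n * b
∑-bound         zero    f≤b = z≤n
∑-bound {b} (suc n) {f} f≤b = begin
  ∣ ∑ n f ℤ.+ f n ∣     ≤⟨ ℤ.∣i+j∣≤∣i∣+∣j∣ (∑ n f) (f n) ⟩
  ∣ ∑ n f ∣ + ∣ f n ∣   ≤⟨ ℕ.+-mono-≤ (∑-bound n (f≤b ∘ ℕ.m≤n⇒m≤1+n)) (f≤b ℕ.≤-refl) ⟩
  n * b + b             ≡⟨ ℕ.+-comm (n * b) b ⟩
  suc n * b             ∎
  where open ℕ.≤-Reasoning

pos-^ : ∀ m n → + (m ^ n) ≡ (+ m) ℤ.^ n
pos-^ m zero    = refl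
pos-^ m (suc n) = trans (ℤ.pos-* m (m ^ n)) (cong (+ m ℤ.*_) (pos-^ m n))

-- Siegel's lemma modulo Q.

finToFun-injective : ∀ {m} n {x y : Fin (m ^ n)} → finToFun {m} {n} x ≗ finToFun y → x ≡ y
finToFun-injective {m} n {x} {y} eq = begin
  x                              ≡⟨ Fin.funToFin-finToFin {n} {m} x ⟨
  funToFin {n} {m} (finToFun x)  ≡⟨ funToFin-cong eq ⟩
  funToFin {n} {m} (finToFun y)  ≡⟨ Fin.funToFin-finToFin {n} {m} y ⟩
  y                              ∎
  where
  open ≡-Reasoning
  funToFin-cong : ∀ {n m} {f g : Fin n → Fin m} → f ≗ g → funToFin f ≡ funToFin g
  funToFin-cong {zero}  eq = refl
  funToFin-cong {suc n} eq = cong₂ combine (eq Fin.zero) (funToFin-cong (eq ∘ Fin.suc))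

≡-%ℕ⇒∣ : ∀ {x y} q .{{_ : NonZero q}} → x ℤ.%ℕ q ≡ y ℤ.%ℕ q → + q ∣ x ℤ.- y
≡-%ℕ⇒∣ {x} {y} q eq = divides (x ℤ./ℕ q ℤ.- y ℤ./ℕ q) (begin
  x ℤ.- y    ≡⟨ cong₂ ℤ._-_ (a≡a%ℕn+[a/ℕn]*n x q) (a≡a%ℕn+[a/ℕn]*n y q) ⟩
  (+ (x ℤ.%ℕ q) ℤ.+ x ℤ./ℕ q ℤ.* + q) ℤ.- (+ (y ℤ.%ℕ q) ℤ.+ y ℤ./ℕ q ℤ.* + q)
             ≡⟨ cong (λ r → (+ r ℤ.+ x ℤ./ℕ q ℤ.* + q) ℤ.- (+ (y ℤ.%ℕ q) ℤ.+ y ℤ./ℕ q ℤ.* + q)) eq ⟩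
  (+ (y ℤ.%ℕ q) ℤ.+ x ℤ./ℕ q ℤ.* + q) ℤ.- (+ (y ℤ.%ℕ q) ℤ.+ y ℤ./ℕ q ℤ.* + q)
             ≡⟨ regroup (+ (y ℤ.%ℕ q)) (x ℤ./ℕ q) (y ℤ./ℕ q) (+ q) ⟩
  (x ℤ./ℕ q ℤ.- y ℤ./ℕ q) ℤ.* + q ∎)
  where
  open ≡-Reasoning
  regroup : ∀ r a b q → (r ℤ.+ a ℤ.* q) ℤ.- (r ℤ.+ b ℤ.* q) ≡ (a ℤ.- b) ℤ.* q
  regroup = solve-∀

module LinearForms (L A : ℕ) (a : ℕ → ℕ → ℤ) where

  -- An element of `Fin (A ^ L)` encodes a vector of L coefficients below A; an index outside the
  -- range gets the default 0.
  coeff : Fin (A ^ L) → ∀ l → Dec (l < L) → ℕ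
  coeff x l (yes l<L) = toℕ (finToFun {A} {L} x (fromℕ< l<L))
  coeff x l (no _)    = 0

  form : Fin (A ^ L) → ℕ → ℤ
  form x t = ∑ L (λ l → + coeff x l (l <? L) ℤ.* a l t)

  coeff≤ : ∀ x l d → coeff x l d ≤ A
  coeff≤ x l (yes l<L) = ℕ.<⇒≤ (Fin.toℕ<n (finToFun x (fromℕ< l<L)))
  coeff≤ x l (no _)    = z≤n

-- There are A^L coefficient vectors but only Q^M vectors of residues of the M forms. Two different
-- coefficient vectors thus give the same residues, and c is their difference.
siegel : ∀ {L M A Q} .{{_ : NonZero Q}} → Q ^ M < A ^ L → (a : ℕ → ℕ → ℤ) → ∃[ c ]
  (∀ l → ∣ c l ∣ ≤ A) × (∃[ l ] l < L × c l ≢ 0ℤ) ×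
  (∀ {t} → t < M → + Q ∣ ∑ L (λ l → c l ℤ.* a l t))
siegel {L} {M} {A} {Q} Q^M<A^L a
  with i , j , i<j , same ← Fin.pigeonhole Q^M<A^L
         (λ x → funToFin {M} {Q} (λ t → fromℕ< (n%ℕd<d (LinearForms.form L A a x (toℕ t)) Q)))
  = c , bound , nonzero , vanish
  where
  open LinearForms L A a
  c : ℕ → ℤ
  c l = + coeff i l (l <? L) ℤ.- + coeff j l (l <? L)
  bound : ∀ l → ∣ c l ∣ ≤ A
  bound l = subst (λ z → ∣ z ∣ ≤ A) (sym (ℤ.[+m]-[+n]≡m⊖n (coeff i l (l <? L)) (coeff j l (l <? L))))
    (ℕ.≤-trans (ℤ.∣m⊝n∣≤m⊔n (coeff i l (l <? L)) _) (ℕ.⊔-lub (coeff≤ i l (l <? L)) (coeff≤ j l (l <? L))))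
  nonzero : ∃[ l ] l < L × c l ≢ 0ℤ
  nonzero with Fin.any? (λ l → ¬? (finToFun {A} {L} i l Fin.≟ finToFun j l))
  ... | yes (l , i≢j) = toℕ l , Fin.toℕ<n l , λ cl≡0 → i≢j (Fin.toℕ-injective (trans (sym (at i))
          (trans (ℤ.+-injective (ℤ.i-j≡0⇒i≡j _ _ cl≡0)) (at j))))
    where
    at : ∀ x → coeff x (toℕ l) (toℕ l <? L) ≡ toℕ (finToFun {A} {L} x l)
    at x with toℕ l <? L
    ... | yes l<L = cong (toℕ ∘ finToFun {A} {L} x) (Fin.fromℕ<-toℕ l l<L)
    ... | no  l≮L = contradiction (Fin.toℕ<n l) l≮L
  ... | no ¬differ = contradiction (finToFun-injective L eq) (Fin.<⇒≢ i<j)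
    where
    eq : finToFun {A} {L} i ≗ finToFun j
    eq l with finToFun {A} {L} i l Fin.≟ finToFun j l
    ... | yes i≡j = i≡j
    ... | no  i≢j = contradiction (l , i≢j) ¬differ
  residue : ∀ t → form i (toℕ t) ℤ.%ℕ Q ≡ form j (toℕ t) ℤ.%ℕ Q
  residue t = begin
    form i (toℕ t) ℤ.%ℕ Q    ≡⟨ at i ⟨
    _                        ≡⟨ cong (λ x → toℕ (finToFun {Q} {M} x t)) same ⟩
    _                        ≡⟨ at j ⟩
    form j (toℕ t) ℤ.%ℕ Q    ∎
    where
    open ≡-Reasoning
    at : ∀ x → toℕ (finToFun {Q} {M} (funToFin {M} {Q} (λ t → fromℕ< (n%ℕd<d (form x (toℕ t)) Q))) t) ≡ form x (toℕ t) ℤ.%ℕ Q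
    at x = trans (cong toℕ (Fin.finToFun-funToFin {M} {Q} _ t)) (Fin.toℕ-fromℕ< (n%ℕd<d (form x (toℕ t)) Q))
  distrib : ∀ x y z → x ℤ.* z ℤ.- y ℤ.* z ≡ (x ℤ.- y) ℤ.* z
  distrib = solve-∀
  vanish : ∀ {t} → t < M → + Q ∣ ∑ L (λ l → c l ℤ.* a l t)
  vanish {t} t<M = subst (+ Q ∣_)
    (trans (∑-minus L (λ l → + coeff i l (l <? L) ℤ.* a l t) (λ l → + coeff j l (l <? L) ℤ.* a l t)) (∑-cong L λ {l} _ → distrib (+ coeff i l (l <? L)) (+ coeff j l (l <? L)) (a l t)))
    (≡-%ℕ⇒∣ {form i t} {form j t} Q (subst (λ t → form i t ℤ.%ℕ Q ≡ form j t ℤ.%ℕ Q) (Fin.toℕ-fromℕ< t<M) (residue (fromℕ< t<M))))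

-- Finite differences.

Δ : (ℕ → ℤ) → ℕ → ℤ
Δ f t = f (suc t) ℤ.- f t

Δ^ : ℕ → (ℕ → ℤ) → ℕ → ℤ
Δ^ zero    f = f
Δ^ (suc n) f = Δ^ n (Δ f)

Δ^-cong : ∀ n {f g} → f ≗ g → Δ^ n f ≗ Δ^ n g
Δ^-cong zero    eq = eq
Δ^-cong (suc n) eq = Δ^-cong n λ t → cong₂ ℤ._-_ (eq (suc t)) (eq t)

Δ^-linear : ∀ n a b f g t → Δ^ n (λ t → a ℤ.* f t ℤ.+ b ℤ.* g t) t ≡ a ℤ.* Δ^ n f t ℤ.+ b ℤ.* Δ^ n g t
Δ^-linear zero    a b f g t = refl
Δ^-linear (suc n) a b f g t = trans
  (Δ^-cong n (λ t → regroup a b (f (suc t)) (f t) (g (suc t)) (g t)) t)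
  (Δ^-linear n a b (Δ f) (Δ g) t)
  where
  regroup : ∀ a b x x′ y y′ → (a ℤ.* x ℤ.+ b ℤ.* y) ℤ.- (a ℤ.* x′ ℤ.+ b ℤ.* y′) ≡ a ℤ.* (x ℤ.- x′) ℤ.+ b ℤ.* (y ℤ.- y′)
  regroup = solve-∀

Δ^-divides : ∀ {q} n {f} → (∀ t → q ∣ f t) → ∀ t → q ∣ Δ^ n f t
Δ^-divides zero    q∣f = q∣f
Δ^-divides (suc n) q∣f = Δ^-divides n λ t → ∣m∣n⇒∣m-n (q∣f (suc t)) (q∣f t)

Δ^-∑-divides : ∀ {q} n L (c : ℕ → ℤ) (f : ℕ → ℕ → ℤ) → (∀ l t → q ∣ Δ^ n (f l) t) →
  ∀ t → q ∣ Δ^ n (λ t → ∑ L (λ l → c l ℤ.* f l t)) t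
Δ^-∑-divides n zero    c f q∣f = Δ^-divides n λ t → divides 0ℤ refl
Δ^-∑-divides {q} n (suc L) c f q∣f t = subst (q ∣_)
  (trans (sym (Δ^-linear n 1ℤ (c L) partial (f L) t))
         (Δ^-cong n (λ t → cong (ℤ._+ c L ℤ.* f L t) (ℤ.*-identityˡ (partial t))) t))
  (∣m∣n⇒∣m+n (∣n⇒∣m*n 1ℤ (Δ^-∑-divides n L c f q∣f t)) (∣n⇒∣m*n (c L) (q∣f L t)))
  where
  partial : ℕ → ℤ
  partial t = ∑ L (λ l → c l ℤ.* f l t)

-- By induction on n the first difference of f vanishes modulo q everywhere; then f is modulo q the
-- constant `f 0`.
divides-all : ∀ {q} n {f} → (∀ {t} → t < n → q ∣ f t) → (∀ t → q ∣ Δ^ n f t) → ∀ t → q ∣ f t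
divides-all zero    initial q∣Δ = q∣Δ
divides-all {q} (suc n) {f} initial q∣Δ = go
  where
  q∣Δf : ∀ t → q ∣ Δ f t
  q∣Δf = divides-all n (λ t<n → ∣m∣n⇒∣m-n (initial (s≤s t<n)) (initial (ℕ.m≤n⇒m≤1+n t<n))) q∣Δ
  go : ∀ t → q ∣ f t
  go zero    = initial (s≤s z≤n)
  go (suc t) = subst (q ∣_) (cancel (f (suc t)) (f t)) (∣m∣n⇒∣m+n (q∣Δf t) (go t))
    where
    cancel : ∀ x y → (x ℤ.- y) ℤ.+ y ≡ x
    cancel = solve-∀

-- Binomial coefficients: differences modulo q and the Newton basis.

nC0≡1 : ∀ n → n C 0 ≡ 1
nC0≡1 n = trans (nCk≡nC[n∸k] {k = 0} {n} z≤n) (nCn≡1 n)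

-- Δ (C(t,i+1) w^t) = (w - 1) C(t,i+1) w^t + w C(t,i) w^t: each difference gains a factor q or lowers i.
C-exp-Δ^-divides : ∀ {q w} → q ∣ w ℤ.- 1ℤ → ∀ e i t →
  q ℤ.^ e ∣ Δ^ (e + i) (λ t → + (t C i) ℤ.* w ℤ.^ t) t
C-exp-Δ^-divides {q} {w} q∣ zero i t = divides (Δ^ i (λ t → + (t C i) ℤ.* w ℤ.^ t) t) (sym (ℤ.*-identityʳ _))
C-exp-Δ^-divides {q} {w} q∣ (suc e) zero t = subst (q ℤ.^ suc e ∣_) (sym eq)
  (∣m∣n⇒∣m+n (product (C-exp-Δ^-divides q∣ e zero t)) (divides {q ℤ.^ suc e} {0ℤ ℤ.* Δ^ (e + 0) φ t} 0ℤ refl))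
  where
  φ : ℕ → ℤ
  φ t = + (t C 0) ℤ.* w ℤ.^ t
  product : ∀ {x} → q ℤ.^ e ∣ x → q ℤ.* q ℤ.^ e ∣ (w ℤ.- 1ℤ) ℤ.* x
  product {x} q∣x = ∣-trans (*-monoˡ-∣ (q ℤ.^ e) q∣) (*-monoʳ-∣ (w ℤ.- 1ℤ) q∣x)
  regroup : ∀ w u → 1ℤ ℤ.* (w ℤ.* u) ℤ.- 1ℤ ℤ.* u ≡ (w ℤ.- 1ℤ) ℤ.* (1ℤ ℤ.* u) ℤ.+ 0ℤ ℤ.* (1ℤ ℤ.* u)
  regroup = solve-∀
  -- For i = 0 there is no lower binomial coefficient; a summand with coefficient 0 brings the
  -- identity into the two-term form of `Δ^-linear`.
  step : ∀ t → φ (suc t) ℤ.- φ t ≡ (w ℤ.- 1ℤ) ℤ.* φ t ℤ.+ 0ℤ ℤ.* φ t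
  step t rewrite nC0≡1 (suc t) | nC0≡1 t = regroup w (w ℤ.^ t)
  eq : Δ^ (suc e + 0) φ t ≡ (w ℤ.- 1ℤ) ℤ.* Δ^ (e + 0) φ t ℤ.+ 0ℤ ℤ.* Δ^ (e + 0) φ t
  eq = trans (Δ^-cong (e + 0) step t) (Δ^-linear (e + 0) (w ℤ.- 1ℤ) 0ℤ φ φ t)
C-exp-Δ^-divides {q} {w} q∣ (suc e) (suc i) t = subst (q ℤ.^ suc e ∣_) (sym eq)
  (∣m∣n⇒∣m+n (product (C-exp-Δ^-divides q∣ e (suc i) t))
    -- Lowering i costs no factor q: the e + (i + 1) remaining differences count as (e + 1) + i.
    (∣n⇒∣m*n w (subst (λ n → q ℤ.^ suc e ∣ Δ^ n (φ i) t) (sym (ℕ.+-suc e i)) (C-exp-Δ^-divides q∣ (suc e) i t))))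
  where
  φ : ℕ → ℕ → ℤ
  φ i t = + (t C i) ℤ.* w ℤ.^ t
  product : ∀ {x} → q ℤ.^ e ∣ x → q ℤ.* q ℤ.^ e ∣ (w ℤ.- 1ℤ) ℤ.* x
  product {x} q∣x = ∣-trans (*-monoˡ-∣ (q ℤ.^ e) q∣) (*-monoʳ-∣ (w ℤ.- 1ℤ) q∣x)
  regroup : ∀ w u a b → (a ℤ.+ b) ℤ.* (w ℤ.* u) ℤ.- b ℤ.* u ≡ (w ℤ.- 1ℤ) ℤ.* (b ℤ.* u) ℤ.+ w ℤ.* (a ℤ.* u)
  regroup = solve-∀
  step : ∀ t → φ (suc i) (suc t) ℤ.- φ (suc i) t ≡ (w ℤ.- 1ℤ) ℤ.* φ (suc i) t ℤ.+ w ℤ.* φ i t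
  step t = trans
    (cong (λ z → z ℤ.* w ℤ.^ suc t ℤ.- φ (suc i) t)
      (trans (cong +_ (sym (nCk+nC[k+1]≡[n+1]C[k+1] t i))) (ℤ.pos-+ (t C i) (t C suc i))))
    (regroup w (w ℤ.^ t) (+ (t C i)) (+ (t C suc i)))
  eq : Δ^ (suc e + suc i) (φ (suc i)) t ≡ (w ℤ.- 1ℤ) ℤ.* Δ^ (e + suc i) (φ (suc i)) t ℤ.+ w ℤ.* Δ^ (e + suc i) (φ i) t
  eq = trans (Δ^-cong (e + suc i) step t) (Δ^-linear (e + suc i) (w ℤ.- 1ℤ) w (φ (suc i)) (φ i) t)

-- The absorption identity (d + 1) C(x, d + 1) = (x - d) C(x, d), arranged without subtraction and
-- proved by Pascal's rule.
C-absorb : ∀ x d → suc d * (x C suc d) + d * (x C d) ≡ x * (x C d)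
C-absorb zero zero    = refl
C-absorb zero (suc d) = trans (cong₂ (λ a b → suc (suc d) * a + suc d * b)
  (k>n⇒nCk≡0 {0} {suc (suc d)} (s≤s z≤n)) (k>n⇒nCk≡0 {0} {suc d} (s≤s z≤n)))
  (cong₂ _+_ (ℕ.*-zeroʳ (suc (suc d))) (ℕ.*-zeroʳ (suc d)))
C-absorb (suc x) zero rewrite nC1≡n (suc x) | nC0≡1 (suc x) = unit x
  where
  unit : ∀ x → 1 * suc x + 0 ≡ suc x * 1
  unit = ℕ-solve-∀
C-absorb (suc x) (suc d) = begin
  suc (suc d) * (suc x C suc (suc d)) + suc d * (suc x C suc d)
    ≡⟨ cong₂ (λ a b → suc (suc d) * a + suc d * b) (pascal (suc d)) (pascal d) ⟨
  suc (suc d) * (b + c) + suc d * (a + b)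
    ≡⟨ regroup d a b c ⟩
  (suc (suc d) * c + suc d * b) + (suc d * b + d * a) + (a + b)
    ≡⟨ cong₂ (λ y z → y + z + (a + b)) (C-absorb x (suc d)) (C-absorb x d) ⟩
  x * b + x * a + (a + b)
    ≡⟨ collect x a b ⟩
  suc x * (a + b)
    ≡⟨ cong (suc x *_) (pascal d) ⟩
  suc x * (suc x C suc d) ∎
  where
  open ≡-Reasoning
  a = x C d
  b = x C suc d
  c = x C suc (suc d)
  pascal : ∀ d → x C d + x C suc d ≡ suc x C suc d
  pascal = nCk+nC[k+1]≡[n+1]C[k+1] x
  regroup : ∀ d a b c → suc (suc d) * (b + c) + suc d * (a + b) ≡
    (suc (suc d) * c + suc d * b) + (suc d * b + d * a) + (a + b)
  regroup = ℕ-solve-∀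
  collect : ∀ x a b → x * b + x * a + (a + b) ≡ suc x * (a + b)
  collect = ℕ-solve-∀

-- The witness is the falling factorial x (x - 1) ... (x - d + 1).
falling : ∀ d → ∃[ f ] Pol d 1ℤ f × (∀ x → f (+ x) ≡ + (d !) ℤ.* + (x C d))
falling zero    = (λ _ → 1ℤ) , const (λ _ → refl) , λ x → cong (λ n → 1ℤ ℤ.* + n) (sym (nC0≡1 x))
falling (suc d) with f , p , eq ← falling d =
  (λ x → (ℤ.- + d ℤ.+ x ℤ.* 1ℤ) ℤ.* f x) ,
  pol-* (horner (ℤ.- + d) (const {f = λ _ → 1ℤ} λ _ → refl) λ _ → refl) p , λ x → begin
    (ℤ.- + d ℤ.+ + x ℤ.* 1ℤ) ℤ.* f (+ x)
      ≡⟨ cong ((ℤ.- + d ℤ.+ + x ℤ.* 1ℤ) ℤ.*_) (eq x) ⟩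
    (ℤ.- + d ℤ.+ + x ℤ.* 1ℤ) ℤ.* (+ (d !) ℤ.* + (x C d))
      ≡⟨ regroup (+ d) (+ x) (+ (d !)) (+ (x C d)) ⟩
    + (d !) ℤ.* (+ x ℤ.* + (x C d) ℤ.- + d ℤ.* + (x C d))
      ≡⟨ cong (λ z → + (d !) ℤ.* (z ℤ.- + d ℤ.* + (x C d))) (absorb x) ⟩
    + (d !) ℤ.* ((+ suc d ℤ.* + (x C suc d) ℤ.+ + d ℤ.* + (x C d)) ℤ.- + d ℤ.* + (x C d))
      ≡⟨ cancel (+ (d !)) (+ suc d) (+ (x C suc d)) (+ d ℤ.* + (x C d)) ⟩
    (+ suc d ℤ.* + (d !)) ℤ.* + (x C suc d)
      ≡⟨ cong (ℤ._* + (x C suc d)) (ℤ.pos-* (suc d) (d !)) ⟨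
    + (suc d !) ℤ.* + (x C suc d) ∎
  where
  open ≡-Reasoning
  regroup : ∀ d x a c → (ℤ.- d ℤ.+ x ℤ.* 1ℤ) ℤ.* (a ℤ.* c) ≡ a ℤ.* (x ℤ.* c ℤ.- d ℤ.* c)
  regroup = solve-∀
  cancel : ∀ a e c z → a ℤ.* ((e ℤ.* c ℤ.+ z) ℤ.- z) ≡ (e ℤ.* a) ℤ.* c
  cancel = solve-∀
  absorb : ∀ x → + x ℤ.* + (x C d) ≡ + suc d ℤ.* + (x C suc d) ℤ.+ + d ℤ.* + (x C d)
  absorb x = begin
    + x ℤ.* + (x C d)    ≡⟨ ℤ.pos-* x (x C d) ⟨
    + (x * (x C d))      ≡⟨ cong +_ (C-absorb x d) ⟨
    + (suc d * (x C suc d) + d * (x C d))       ≡⟨ ℤ.pos-+ (suc d * (x C suc d)) _ ⟩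
    + (suc d * (x C suc d)) ℤ.+ + (d * (x C d)) ≡⟨ cong₂ ℤ._+_ (ℤ.pos-* (suc d) (x C suc d)) (ℤ.pos-* d (x C d)) ⟩
    + suc d ℤ.* + (x C suc d) ℤ.+ + d ℤ.* + (x C d) ∎

newton : ℕ → (ℕ → ℤ) → ℕ → ℤ
newton n c x = ∑ n (λ i → c i ℤ.* + (x C i))

-- Only C(x, d) reaches degree d, and d! C(x, d) is monic; hence the leading coefficient is `c d`.
newton-pol : ∀ d c → ∃[ f ] Pol d (c d) f × (∀ x → f (+ x) ≡ + (d !) ℤ.* newton (suc d) c x)
newton-pol zero c = (λ _ → c 0) , const (λ _ → refl) , λ x →
  trans (unit (c 0)) (cong (λ n → 1ℤ ℤ.* (0ℤ ℤ.+ c 0 ℤ.* + n)) (sym (nC0≡1 x)))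
  where
  unit : ∀ c → c ≡ 1ℤ ℤ.* (0ℤ ℤ.+ c ℤ.* 1ℤ)
  unit = solve-∀
newton-pol (suc d) c with f , p , ef ← newton-pol d c | g , q , eg ← falling (suc d) =
  (λ x → + suc d ℤ.* f x ℤ.+ c (suc d) ℤ.* g x) ,
  subst (λ l → Pol (suc d) l λ x → + suc d ℤ.* f x ℤ.+ c (suc d) ℤ.* g x) (leading (c (suc d))) (pol-+ (pol-raise (pol-scale (+ suc d) p)) (pol-scale (c (suc d)) q)) ,
  λ x → trans (cong₂ (λ y z → + suc d ℤ.* y ℤ.+ c (suc d) ℤ.* z) (ef x) (eg x))
    (trans (cong (λ z → + suc d ℤ.* (+ (d !) ℤ.* newton (suc d) c x) ℤ.+ c (suc d) ℤ.* (z ℤ.* + (x C suc d)))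
              (ℤ.pos-* (suc d) (d !)))
      (trans (regroup (+ suc d) (+ (d !)) (newton (suc d) c x) (c (suc d)) (+ (x C suc d)))
             (cong (ℤ._* newton (suc (suc d)) c x) (sym (ℤ.pos-* (suc d) (d !))))))
  where
  leading : ∀ l → 0ℤ ℤ.+ l ℤ.* 1ℤ ≡ l
  leading = solve-∀
  regroup : ∀ e a n c b → e ℤ.* (a ℤ.* n) ℤ.+ c ℤ.* (e ℤ.* a ℤ.* b) ≡ e ℤ.* a ℤ.* (n ℤ.+ c ℤ.* b)
  regroup = solve-∀

-- Vanishing top coefficients are dropped until a nonzero one is met, which then serves as the
-- leading coefficient.
newton-zero-or-pol : ∀ n c →
  ((∀ {i} → i < n → c i ≡ 0ℤ) × (∀ x → newton n c x ≡ 0ℤ)) ⊎ PolMultiple n (newton n c)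
newton-zero-or-pol zero    c = inj₁ ((λ ()) , λ _ → refl)
newton-zero-or-pol (suc d) c with c d ℤ.≟ 0ℤ
... | no cd≢0 with f , p , eq ← newton-pol d c = inj₂ record
  { degree≤ = ℕ.n≤1+n d ; ρ≢0 = λ eq → ℕ.m<n⇒n≢0 (ℕ.1≤n! d) (ℤ.+-injective eq) ; leading≢0 = cd≢0 ; isPol = p ; multiple = eq }
... | yes cd≡0 = Sum.map
  (λ (zeros , vanish) → (λ {i} i<1+d → Sum.[ zeros , (λ { refl → cd≡0 }) ] (ℕ.m≤n⇒m<n∨m≡n (ℕ.≤-pred i<1+d)))
                      , λ x → trans (top x) (vanish x))
  (λ P → let open PolMultiple P in record
    { degree≤ = ℕ.m≤n⇒m≤1+n degree≤ ; ρ≢0 = ρ≢0 ; leading≢0 = leading≢0 ; isPol = isPol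
    ; multiple = λ x → trans (multiple x) (cong (ρ ℤ.*_) (sym (top x))) })
  (newton-zero-or-pol d c)
  where
  top : ∀ x → newton (suc d) c x ≡ newton d c x
  top x = trans (cong (λ z → newton d c x ℤ.+ z ℤ.* + (x C d)) cd≡0) (ℤ.+-identityʳ _)

-- The auxiliary function and its vanishing on the grid.

^-cong-∣ : ∀ {q x y} n → q ∣ x ℤ.- y → q ∣ x ℤ.^ n ℤ.- y ℤ.^ n
^-cong-∣ zero    q∣ = divides 0ℤ refl
^-cong-∣ {q} {x} {y} (suc n) q∣ = subst (q ∣_) (regroup x y (x ℤ.^ n) (y ℤ.^ n))
  (∣m∣n⇒∣m+n (∣n⇒∣m*n x (^-cong-∣ n q∣)) (∣m⇒∣m*n (y ℤ.^ n) q∣))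
  where
  regroup : ∀ x y u v → x ℤ.* (u ℤ.- v) ℤ.+ (x ℤ.- y) ℤ.* v ≡ x ℤ.* u ℤ.- y ℤ.* v
  regroup = solve-∀

∣-<⇒≡0 : ∀ {q x} → + q ∣ x → ∣ x ∣ < q → x ≡ 0ℤ
∣-<⇒≡0 {q} {x} q∣x x<q with ∣ x ∣ in eq | ∣⇒∣ᵤ q∣x
... | zero  | _    = ℤ.∣i∣≡0⇒i≡0 eq
... | suc _ | q∣ᵤx = contradiction (ℕᵈ.∣⇒≤ q∣ᵤx) (ℕ.<⇒≱ x<q)

^-injective : ∀ {w i j} → 1 < w → i < j → (+ w) ℤ.^ j ≢ (+ w) ℤ.^ i
^-injective {w} {i} {j} 1<w i<j eq = ℕ.<⇒≢ (ℕ.^-monoʳ-< w 1<w i<j)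
  (ℤ.+-injective (trans (pos-^ w i) (trans (sym eq) (sym (pos-^ w j)))))

module _ (k w b I : ℕ) (1<w : 1 < w) (1≤b : 1 ≤ b) (c : ℕ → ℤ) where

  open ZeroEstimate k

  -- The coefficient of y^j in the auxiliary polynomial, in the binomial basis.
  block : ℕ → ℕ → ℤ
  block j = newton I (λ i → c (i + j * I))

  -- Zero blocks are left out, because the zero estimate asks for nonzero leading coefficients. The
  -- field `powers` shows that the next power of w is new, and `empty` says what it means that no
  -- block is left.
  record Terms (J : ℕ) : Set where
    field
      terms     : List Term
      distinct  : AllPairs (λ t t′ → Term.ω t ≢ Term.ω t′) terms
      good      : All (Good I) terms
      powers    : All (λ t → ∃[ j ] j < J × Term.ω t ≡ (+ w) ℤ.^ j) terms
      length≤   : length terms ≤ J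
      eval≡     : ∀ r s → eval r s terms ≡
                    ∑ J (λ j → block j (r + s * k) ℤ.* (((+ w) ℤ.^ j) ℤ.^ r ℤ.* ((+ b) ℤ.^ j) ℤ.^ s))
      empty     : terms ≡ [] → ∀ {i j} → i < I → j < J → c (i + j * I) ≡ 0ℤ

  collect-terms : ∀ J → Terms J
  collect-terms zero = record
    { distinct = [] ; good = [] ; powers = [] ; length≤ = z≤n ; eval≡ = λ r s → refl ; empty = λ _ _ () }
  collect-terms (suc J) with newton-zero-or-pol I (λ i → c (i + J * I))
  ... | inj₁ (zeros , vanish) = record
    { distinct = distinct
    ; good     = good
    ; powers   = All.map (λ (j , j<J , eq) → j , ℕ.m≤n⇒m≤1+n j<J , eq) powers
    ; length≤  = ℕ.m≤n⇒m≤1+n length≤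
    ; eval≡    = λ r s → trans (eval≡ r s) (sym (trans
        (cong (λ z → ∑ J (λ j → block j (r + s * k) ℤ.* (((+ w) ℤ.^ j) ℤ.^ r ℤ.* ((+ b) ℤ.^ j) ℤ.^ s)) ℤ.+
                     z ℤ.* (((+ w) ℤ.^ J) ℤ.^ r ℤ.* ((+ b) ℤ.^ J) ℤ.^ s)) (vanish (r + s * k)))
        (ℤ.+-identityʳ _)))
    ; empty    = λ e {i} {j} i<I j<1+J → Sum.[ empty e i<I , (λ { refl → zeros i<I }) ] (ℕ.m≤n⇒m<n∨m≡n (ℕ.≤-pred j<1+J))
    }
    where open Terms (collect-terms J)
  ... | inj₂ P = record
    { terms    = new ∷ terms
    ; distinct = All.map (λ (j , j<J , eq) eq′ → ^-injective 1<w j<J (trans eq′ eq)) powers ∷ distinct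
    ; good     = (^-≢0 J (ℕ.m<n⇒n≢0 1≤b ∘ ℤ.+-injective) , ^-≢0 J (ℕ.m<n⇒n≢0 1<w ∘ ℤ.+-injective) , P) ∷ good
    ; powers   = (J , ℕ.≤-refl , refl) ∷ All.map (λ (j , j<J , eq) → j , ℕ.m≤n⇒m≤1+n j<J , eq) powers
    ; length≤  = s≤s length≤
    ; eval≡    = λ r s → trans (ℤ.+-comm (value r s new) (eval r s terms)) (cong (ℤ._+ value r s new) (eval≡ r s))
    ; empty    = λ ()
    }
    where
    open Terms (collect-terms J)
    new = mkTerm ((+ w) ℤ.^ J) ((+ b) ℤ.^ J) (block J)

  -- A nonempty list of remaining terms contradicts the zero estimate. The list may be shorter than
  -- n + 1, which only relaxes the bound and shrinks the range of r required.
  grid-zeros : ∀ n {R T} → R ≤ k → 2 ^ n * I < R * T →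
    (∀ {r s} → r < n + R → s < T →
      ∑ (suc n) (λ j → block j (r + s * k) ℤ.* (((+ w) ℤ.^ j) ℤ.^ r ℤ.* ((+ b) ℤ.^ j) ℤ.^ s)) ≡ 0ℤ) →
    ∀ {i j} → i < I → j < suc n → c (i + j * I) ≡ 0ℤ
  grid-zeros n R≤k bound vanish with collect-terms (suc n)
  ... | record { terms = [] ; empty = empty } = empty refl
  ... | record { terms = t ∷ ts ; distinct = distinct ; good = good ; length≤ = s≤s len≤ ; eval≡ = eval≡ } =
    contradiction (λ {r} {s} r< s<T → trans (eval≡ r s) (vanish (ℕ.<-≤-trans r< (ℕ.+-monoˡ-≤ _ len≤)) s<T))
      (zero-estimate (length ts) t ts refl distinct good R≤k
        (ℕ.≤-<-trans (ℕ.*-monoˡ-≤ I (ℕ.^-monoʳ-≤ 2 len≤)) bound))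

[i+j*I]%I≡i : ∀ {i I} j .{{_ : NonZero I}} → i < I → (i + j * I) % I ≡ i
[i+j*I]%I≡i {i} {I} j i<I = trans ([m+kn]%n≡m%n i j I) (m<n⇒m%n≡m i<I)

[i+j*I]/I≡j : ∀ {i I} j .{{_ : NonZero I}} → i < I → (i + j * I) / I ≡ j
[i+j*I]/I≡j {i} {I} j i<I =
  trans (+-distrib-/-∣ʳ i (ℕᵈ.n∣m*n j)) (cong₂ _+_ (m<n⇒m/n≡0 i<I) (m*n/n≡m j I))

-- Here `A` bounds the coefficients c_ij with i < I and j ≤ n, `R` and `T` describe the grid, and
-- `Y` bounds the monomials on it. The hypothesis `many` is the pigeonhole condition for N + I
-- congruences modulo q^N; `small` puts the grid values below the modulus.
module Interpolation {w b k q N I n A R T Y : ℕ} .{{_ : NonZero q}} .{{_ : NonZero I}} (1<w : 1 < w) (1≤b : 1 ≤ b)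
  (q∣w-1 : + q ∣ + w ℤ.- 1ℤ) (qᴺ∣wᵏ-b : (+ q) ℤ.^ N ∣ (+ w) ℤ.^ k ℤ.- + b)
  (many : (q ^ N) ^ (N + I) < A ^ (suc n * I))
  (size : ∀ {r s i j} → r < n + R → s < T → i < I → j ≤ n → ((r + s * k) C i) * ((w ^ j) ^ r * (b ^ j) ^ s) ≤ Y)
  (small : suc n * I * (A * Y) < q ^ N)
  where

  L = suc n * I
  Q = q ^ N
  ω = + w
  β = + b
  a : ℕ → ℕ → ℤ
  a l t = + (t C (l % I)) ℤ.* (ω ℤ.^ (l / I)) ℤ.^ t
  -- With i = l % I < I, the N + I differences yield N + (I - i) factors q, which is at least N.
  Δa : ∀ l t → + Q ∣ Δ^ (N + I) (a l) t
  Δa l t = subst (λ M → + Q ∣ Δ^ M (a l) t) exponent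
    (∣-trans (divides ((+ q) ℤ.^ (I ∸ l % I)) quotient)
      (C-exp-Δ^-divides {+ q} {ω ℤ.^ (l / I)} q∣ω^j-1 (N + (I ∸ l % I)) (l % I) t))
    where
    exponent : N + (I ∸ l % I) + l % I ≡ N + I
    exponent = trans (ℕ.+-assoc N (I ∸ l % I) (l % I)) (cong (λ x → N + x) (ℕ.m∸n+n≡m (ℕ.<⇒≤ (m%n<n l I))))
    quotient : (+ q) ℤ.^ (N + (I ∸ l % I)) ≡ (+ q) ℤ.^ (I ∸ l % I) ℤ.* + Q
    quotient = trans (ℤ.^-distribˡ-+-* (+ q) N (I ∸ l % I))
      (trans (ℤ.*-comm ((+ q) ℤ.^ N) ((+ q) ℤ.^ (I ∸ l % I))) (cong ((+ q) ℤ.^ (I ∸ l % I) ℤ.*_) (sym (pos-^ q N))))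
    q∣ω^j-1 : + q ∣ ω ℤ.^ (l / I) ℤ.- 1ℤ
    q∣ω^j-1 = subst (λ z → + q ∣ ω ℤ.^ (l / I) ℤ.- z) (ℤ.^-zeroˡ (l / I)) (^-cong-∣ (l / I) q∣w-1)
  module Coefficients (c : ℕ → ℤ) (c≤A : ∀ l → ∣ c l ∣ ≤ A)
    (initial : ∀ {t} → t < N + I → + Q ∣ ∑ L (λ l → c l ℤ.* a l t)) where

    F : ℕ → ℤ
    F t = ∑ L (λ l → c l ℤ.* a l t)
    Q∣F : ∀ t → + Q ∣ F t
    Q∣F = divides-all (N + I) initial (Δ^-∑-divides (N + I) L c a Δa)
    -- The monomial `a l` at r + s k, with w^k replaced by b. The sum `G` is therefore congruent to
    -- `F` there, but small.
    g : ℕ → ℕ → ℕ → ℤ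
    g r s l = + ((r + s * k) C (l % I)) ℤ.* ((ω ℤ.^ (l / I)) ℤ.^ r ℤ.* (β ℤ.^ (l / I)) ℤ.^ s)
    G : ℕ → ℕ → ℤ
    G r s = ∑ L (λ l → c l ℤ.* g r s l)
    powers : ∀ r s j → (ω ℤ.^ j) ℤ.^ (r + s * k) ≡ (ω ℤ.^ j) ℤ.^ r ℤ.* (((ω ℤ.^ k) ℤ.^ j) ℤ.^ s)
    powers r s j = trans (ℤ.^-distribˡ-+-* (ω ℤ.^ j) r (s * k)) (cong ((ω ℤ.^ j) ℤ.^ r ℤ.*_) (begin
      (ω ℤ.^ j) ℤ.^ (s * k)     ≡⟨ ℤ.^-*-assoc ω j (s * k) ⟩
      ω ℤ.^ (j * (s * k))       ≡⟨ cong (ω ℤ.^_) (commute j s k) ⟩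
      ω ℤ.^ (k * j * s)         ≡⟨ ℤ.^-*-assoc ω (k * j) s ⟨
      (ω ℤ.^ (k * j)) ℤ.^ s     ≡⟨ cong (ℤ._^ s) (ℤ.^-*-assoc ω k j) ⟨
      ((ω ℤ.^ k) ℤ.^ j) ℤ.^ s   ∎))
      where
      open ≡-Reasoning
      commute : ∀ j s k → j * (s * k) ≡ k * j * s
      commute = ℕ-solve-∀
    Q∣F-G : ∀ r s → + Q ∣ F (r + s * k) ℤ.- G r s
    Q∣F-G r s = subst (+ Q ∣_) (sym (∑-minus L (λ l → c l ℤ.* a l (r + s * k)) (λ l → c l ℤ.* g r s l)))
      (∑-divides L λ l → subst (+ Q ∣_) (eq l)
        (∣n⇒∣m*n (c l ℤ.* + ((r + s * k) C (l % I)) ℤ.* (ω ℤ.^ (l / I)) ℤ.^ r)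
          (^-cong-∣ s (^-cong-∣ (l / I) (subst (_∣ ω ℤ.^ k ℤ.- β) (sym (pos-^ q N)) qᴺ∣wᵏ-b)))))
      where
      regroup : ∀ c x u v v′ → c ℤ.* x ℤ.* u ℤ.* (v ℤ.- v′) ≡ c ℤ.* (x ℤ.* (u ℤ.* v)) ℤ.- c ℤ.* (x ℤ.* (u ℤ.* v′))
      regroup = solve-∀
      eq : ∀ l → c l ℤ.* + ((r + s * k) C (l % I)) ℤ.* (ω ℤ.^ (l / I)) ℤ.^ r ℤ.*
                   (((ω ℤ.^ k) ℤ.^ (l / I)) ℤ.^ s ℤ.- (β ℤ.^ (l / I)) ℤ.^ s) ≡
                 c l ℤ.* a l (r + s * k) ℤ.- c l ℤ.* g r s l
      eq l = trans (regroup (c l) (+ ((r + s * k) C (l % I))) ((ω ℤ.^ (l / I)) ℤ.^ r)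
                            (((ω ℤ.^ k) ℤ.^ (l / I)) ℤ.^ s) ((β ℤ.^ (l / I)) ℤ.^ s))
        (cong (λ z → c l ℤ.* (+ ((r + s * k) C (l % I)) ℤ.* z) ℤ.- c l ℤ.* g r s l) (sym (powers r s (l / I))))
    Q∣G : ∀ r s → + Q ∣ G r s
    Q∣G r s = subst (+ Q ∣_) (cancel (F (r + s * k)) (G r s)) (∣m∣n⇒∣m-n (Q∣F (r + s * k)) (Q∣F-G r s))
      where
      cancel : ∀ x y → x ℤ.- (x ℤ.- y) ≡ y
      cancel = solve-∀
    module _ {r s : ℕ} (r< : r < n + R) (s<T : s < T) where
      g-natural : ∀ l → g r s l ≡ + (((r + s * k) C (l % I)) * ((w ^ (l / I)) ^ r * (b ^ (l / I)) ^ s))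
      g-natural l = sym (begin
        + (x * (u * v))                ≡⟨ ℤ.pos-* x (u * v) ⟩
        + x ℤ.* + (u * v)              ≡⟨ cong (+ x ℤ.*_) (ℤ.pos-* u v) ⟩
        + x ℤ.* (+ u ℤ.* + v)          ≡⟨ cong₂ (λ y z → + x ℤ.* (y ℤ.* z)) (double w r) (double b s) ⟩
        g r s l                        ∎)
        where
        open ≡-Reasoning
        x = (r + s * k) C (l % I)
        u = (w ^ (l / I)) ^ r
        v = (b ^ (l / I)) ^ s
        double : ∀ y m → + ((y ^ (l / I)) ^ m) ≡ ((+ y) ℤ.^ (l / I)) ℤ.^ m
        double y m = trans (pos-^ (y ^ (l / I)) m) (cong (ℤ._^ m) (pos-^ y (l / I)))
      G-small : ∣ G r s ∣ < Q
      G-small = ℕ.≤-<-trans (∑-bound L λ {l} l<L → begin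
        ∣ c l ℤ.* g r s l ∣       ≡⟨ ℤ.abs-* (c l) (g r s l) ⟩
        ∣ c l ∣ * ∣ g r s l ∣     ≤⟨ ℕ.*-mono-≤ (c≤A l) (subst (λ z → ∣ z ∣ ≤ Y) (sym (g-natural l))
                                      (size r< s<T (m%n<n l I) (ℕ.≤-pred (m<n*o⇒m/o<n {n = suc n} l<L)))) ⟩
        A * Y                     ∎) small
        where open ℕ.≤-Reasoning
      vanish : ∑ (suc n) (λ j → block k w b I 1<w 1≤b c j (r + s * k) ℤ.* ((ω ℤ.^ j) ℤ.^ r ℤ.* (β ℤ.^ j) ℤ.^ s)) ≡ 0ℤ
      vanish = begin
        ∑ (suc n) (λ j → block k w b I 1<w 1≤b c j (r + s * k) ℤ.* y j)      ≡⟨ ∑-cong (suc n) (λ {j} _ → inner j) ⟩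
        ∑ (suc n) (λ j → ∑ I (λ i → c (i + j * I) ℤ.* g r s (i + j * I)))    ≡⟨ ∑-blocks (suc n) I (λ l → c l ℤ.* g r s l) ⟨
        G r s                                                                ≡⟨ ∣-<⇒≡0 (Q∣G r s) G-small ⟩
        0ℤ                                                                   ∎
        where
        open ≡-Reasoning
        y : ℕ → ℤ
        y j = (ω ℤ.^ j) ℤ.^ r ℤ.* (β ℤ.^ j) ℤ.^ s
        inner : ∀ j → newton I (λ i → c (i + j * I)) (r + s * k) ℤ.* y j ≡ ∑ I (λ i → c (i + j * I) ℤ.* g r s (i + j * I))
        inner j = trans (∑-*-distribʳ I (λ i → c (i + j * I) ℤ.* + ((r + s * k) C i)) (y j))
          (∑-cong I λ {i} i<I → trans (ℤ.*-assoc (c (i + j * I)) (+ ((r + s * k) C i)) (y j))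
            (cong₂ (λ x z → c (i + j * I) ℤ.* (+ ((r + s * k) C x) ℤ.* y z))
              (sym ([i+j*I]%I≡i j i<I)) (sym ([i+j*I]/I≡j j i<I))))

  contradictory : R ≤ k → ¬ (2 ^ n * I < R * T)
  contradictory R≤k bound = conclude (siegel {L} {N + I} {A} {Q} {{ℕ.m^n≢0 q N}} many a)
    where
    conclude : ¬ (∃[ c ] (∀ l → ∣ c l ∣ ≤ A) × (∃[ l ] l < L × c l ≢ 0ℤ) ×
      (∀ {t} → t < N + I → + Q ∣ ∑ L (λ l → c l ℤ.* a l t)))
    conclude (c , c≤A , (l₀ , l₀<L , cl₀≢0) , initial) = cl₀≢0 (trans (cong c (m≡m%n+[m/n]*n l₀ I))
      (grid-zeros k w b I 1<w 1≤b c n R≤k bound (Coefficients.vanish c c≤A initial)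
        (m%n<n l₀ I) (m<n*o⇒m/o<n l₀<L)))

-- Size estimates.

-- A single term of the binomial expansion of (1 + 1/D)^x is at most the whole; denominators are
-- cleared.
C-exp-bound : ∀ D x i → (x C i) * D ^ x ≤ D ^ i * suc D ^ x
C-exp-bound D zero zero    = ℕ.≤-refl
C-exp-bound D zero (suc i) = ℕ.≤-trans (ℕ.≤-reflexive (cong (_* 1) (k>n⇒nCk≡0 {0} {suc i} (s≤s z≤n)))) z≤n
C-exp-bound D (suc x) zero = begin
  (suc x C 0) * D ^ suc x    ≡⟨ cong (_* D ^ suc x) (nC0≡1 (suc x)) ⟩
  1 * D ^ suc x              ≤⟨ ℕ.*-monoʳ-≤ 1 (ℕ.^-monoˡ-≤ (suc x) (ℕ.n≤1+n D)) ⟩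
  1 * suc D ^ suc x          ∎
  where open ℕ.≤-Reasoning
C-exp-bound D (suc x) (suc i) = begin
  (suc x C suc i) * D ^ suc x                               ≡⟨ cong (_* D ^ suc x) (nCk+nC[k+1]≡[n+1]C[k+1] x i) ⟨
  (x C i + x C suc i) * (D * D ^ x)                         ≡⟨ expand (x C i) (x C suc i) D (D ^ x) ⟩
  D * ((x C i) * D ^ x) + D * ((x C suc i) * D ^ x)         ≤⟨ ℕ.+-mono-≤ (ℕ.*-monoʳ-≤ D (C-exp-bound D x i)) (ℕ.*-monoʳ-≤ D (C-exp-bound D x (suc i))) ⟩
  D * (D ^ i * suc D ^ x) + D * (D ^ suc i * suc D ^ x)     ≡⟨ collect D (D ^ i) (suc D ^ x) ⟩
  D ^ suc i * suc D ^ suc x                                 ∎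
  where
  open ℕ.≤-Reasoning
  expand : ∀ a b D y → (a + b) * (D * y) ≡ D * (a * y) + D * (b * y)
  expand = ℕ-solve-∀
  collect : ∀ D a b → D * (a * b) + D * (D * a * b) ≡ D * a * (suc D * b)
  collect = ℕ-solve-∀

C-monoˡ-≤ : ∀ {x y} i → x ≤ y → x C i ≤ y C i
C-monoˡ-≤ i x≤y = go i (ℕ.≤⇒≤′ x≤y)
  where
  step : ∀ x i → x C i ≤ suc x C i
  step x zero    = ℕ.≤-reflexive (trans (nC0≡1 x) (sym (nC0≡1 (suc x))))
  step x (suc i) = ℕ.≤-trans (ℕ.m≤n+m _ (x C i)) (ℕ.≤-reflexive (nCk+nC[k+1]≡[n+1]C[k+1] x i))
  go : ∀ {x y} i → x ≤′ y → x C i ≤ y C i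
  go i ≤′-refl         = ℕ.≤-refl
  go i (≤′-step {y} x≤y) = ℕ.≤-trans (go i x≤y) (step y i)

-- (D + 1)^j ≤ D^j / (1 - j/D), cleared of denominators with d = D - j.
bernoulli : ∀ {D} j d → d + j ≡ D → d * suc D ^ j ≤ D ^ suc j
bernoulli {D} zero    d eq = ℕ.≤-reflexive (cong (_* 1) (trans (sym (ℕ.+-identityʳ d)) eq))
bernoulli {D} (suc j) d eq = begin
  d * (suc D * suc D ^ j)          ≡⟨ expand d D (suc D ^ j) ⟩
  (d + d * D) * suc D ^ j          ≤⟨ ℕ.*-monoˡ-≤ (suc D ^ j) (ℕ.+-monoˡ-≤ (d * D) (ℕ.m+n≤o⇒m≤o d (ℕ.≤-reflexive eq))) ⟩
  (D + d * D) * suc D ^ j          ≡⟨ collect d D (suc D ^ j) ⟩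
  D * (suc d * suc D ^ j)          ≤⟨ ℕ.*-monoʳ-≤ D (bernoulli j (suc d) (trans (sym (ℕ.+-suc d j)) eq)) ⟩
  D * D ^ suc j                    ∎
  where
  open ℕ.≤-Reasoning
  expand : ∀ d D y → d * (suc D * y) ≡ (d + d * D) * y
  expand = ℕ-solve-∀
  collect : ∀ d D y → (D + d * D) * y ≡ D * (suc d * y)
  collect = ℕ-solve-∀

-- This is (1 + 1/D)^e ≤ 2 for D = 2 e, the case j = d = e of `bernoulli`.
[1+D]^e≤2*D^e : ∀ e .{{_ : NonZero e}} → suc (2 * e) ^ e ≤ 2 * (2 * e) ^ e
[1+D]^e≤2*D^e e = ℕ.*-cancelˡ-≤ e (begin
  e * suc (2 * e) ^ e        ≤⟨ bernoulli e e (cong (λ x → e + x) (sym (ℕ.+-identityʳ e))) ⟩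
  2 * e * (2 * e) ^ e        ≡⟨ swap e ((2 * e) ^ e) ⟩
  e * (2 * (2 * e) ^ e)      ∎)
  where
  open ℕ.≤-Reasoning
  swap : ∀ e y → 2 * e * y ≡ e * (2 * y)
  swap = ℕ-solve-∀

^-distribʳ-* : ∀ x y n → (x * y) ^ n ≡ x ^ n * y ^ n
^-distribʳ-* x y zero    = refl
^-distribʳ-* x y (suc n) = trans (cong (x * y *_) (^-distribʳ-* x y n)) (regroup x y (x ^ n) (y ^ n))
  where
  regroup : ∀ x y u v → x * y * (u * v) ≡ x * u * (y * v)
  regroup = ℕ-solve-∀

-- For y = D g with D = 2 e, the estimate C(y, i) ≤ D^i (1 + 1/D)^y is combined with (1 + 1/D)^y =
-- ((1 + 1/D)^e)^(2g) ≤ 4^g.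
C-bound : ∀ {e g x i} .{{_ : NonZero e}} → x ≤ 2 * e * g → i ≤ g → x C i ≤ (4 * (2 * e)) ^ g
C-bound {e} {g} {x} {i} x≤ i≤g = ℕ.≤-trans (C-monoˡ-≤ i x≤) (ℕ.*-cancelʳ-≤ _ _ (D ^ y) {{D^y≢0}} (begin
  (y C i) * D ^ y                ≤⟨ C-exp-bound D y i ⟩
  D ^ i * suc D ^ y              ≤⟨ ℕ.*-mono-≤ (ℕ.^-monoʳ-≤ D {{D≢0}} i≤g) growth ⟩
  D ^ g * (4 ^ g * D ^ y)        ≡⟨ swap (D ^ g) (4 ^ g) (D ^ y) ⟩
  4 ^ g * D ^ g * D ^ y          ≡⟨ cong (_* D ^ y) (^-distribʳ-* 4 D g) ⟨
  (4 * D) ^ g * D ^ y            ∎))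
  where
  open ℕ.≤-Reasoning
  D = 2 * e
  y = D * g
  D≢0 : NonZero D
  D≢0 = ℕ.m*n≢0 2 e
  D^y≢0 : NonZero (D ^ y)
  D^y≢0 = ℕ.m^n≢0 D y {{D≢0}}
  swap : ∀ a b c → a * (b * c) ≡ b * a * c
  swap = ℕ-solve-∀
  exponent : ∀ e g → 2 * e * g ≡ e * (2 * g)
  exponent = ℕ-solve-∀
  growth : suc D ^ y ≤ 4 ^ g * D ^ y
  growth = begin
    suc D ^ y                      ≡⟨ cong (suc D ^_) (exponent e g) ⟩
    suc D ^ (e * (2 * g))          ≡⟨ ℕ.^-*-assoc (suc D) e (2 * g) ⟨
    (suc D ^ e) ^ (2 * g)          ≤⟨ ℕ.^-monoˡ-≤ (2 * g) ([1+D]^e≤2*D^e e) ⟩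
    (2 * D ^ e) ^ (2 * g)          ≡⟨ ^-distribʳ-* 2 (D ^ e) (2 * g) ⟩
    2 ^ (2 * g) * (D ^ e) ^ (2 * g) ≡⟨ cong₂ _*_ (sym (ℕ.^-*-assoc 2 2 g)) (trans (ℕ.^-*-assoc D e (2 * g)) (cong (D ^_) (sym (exponent e g)))) ⟩
    4 ^ g * D ^ y                  ∎

n<2^n : ∀ n → n < 2 ^ n
n<2^n zero    = s≤s z≤n
n<2^n (suc n) = begin-strict
  suc n              ≤⟨ n<2^n n ⟩
  2 ^ n              <⟨ ℕ.m<m+n (2 ^ n) (ℕ.m^n>0 2 n) ⟩
  2 ^ n + 2 ^ n      ≡⟨ cong (λ x → 2 ^ n + x) (ℕ.+-identityʳ (2 ^ n)) ⟨
  2 ^ suc n          ∎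
  where open ℕ.≤-Reasoning

2*n≤2^n : ∀ n → 2 * n ≤ 2 ^ n
2*n≤2^n zero    = z≤n
2*n≤2^n (suc n) = ℕ.*-monoʳ-≤ 2 (n<2^n n)

-- Used to choose h = 2 c such that p^h exceeds a given multiple of h.
c*h≤p^h : ∀ {p} → 1 < p → ∀ c → c * (2 * c) ≤ p ^ (2 * c)
c*h≤p^h {p} 1<p c = begin
  c * (2 * c)        ≤⟨ ℕ.*-mono-≤ (ℕ.<⇒≤ (n<2^n c)) (2*n≤2^n c) ⟩
  2 ^ c * 2 ^ c      ≡⟨ ℕ.^-distribˡ-+-* 2 c c ⟨
  2 ^ (c + c)        ≡⟨ cong (λ x → 2 ^ (c + x)) (ℕ.+-identityʳ c) ⟨
  2 ^ (2 * c)        ≤⟨ ℕ.^-monoˡ-≤ (2 * c) 1<p ⟩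
  p ^ (2 * c)        ∎
  where open ℕ.≤-Reasoning

-- Powers of m modulo p^h.

module _ {p m} (pp : Prime p) (p∤m : ¬ (p ℕᵈ.∣ m)) where

  p∤m^n : ∀ n → ¬ (p ℕᵈ.∣ m ^ n)
  p∤m^n zero    p∣1 = ℕ.<⇒≱ (nonTrivial⇒n>1 p {{prime⇒nonTrivial pp}}) (ℕᵈ.∣⇒≤ p∣1)
  p∤m^n (suc n) p∣  = Sum.[ p∤m , p∤m^n n ] (euclidsLemma m (m ^ n) pp p∣)

  p^h∣m^n*y⇒p^h∣y : ∀ h n {y} → p ^ h ℕᵈ.∣ m ^ n * y → p ^ h ℕᵈ.∣ y
  p^h∣m^n*y⇒p^h∣y zero    n _ = ℕᵈ.1∣ _
  p^h∣m^n*y⇒p^h∣y (suc h) n {y} d with euclidsLemma (m ^ n) y pp (ℕᵈ.∣-trans (ℕᵈ.m∣m*n (p ^ h)) d)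
  ... | inj₁ p∣m^n = contradiction p∣m^n (p∤m^n n)
  ... | inj₂ (ℕᵈ.divides y′ refl) = subst (p ^ suc h ℕᵈ.∣_) (ℕ.*-comm p y′) (ℕᵈ.*-monoʳ-∣ p
    (p^h∣m^n*y⇒p^h∣y h n (ℕᵈ.*-cancelˡ-∣ p {{prime⇒nonZero pp}} (subst (p ^ suc h ℕᵈ.∣_) (rotate (m ^ n) y′ p) d))))
    where
    rotate : ∀ a y p → a * (y * p) ≡ p * (a * y)
    rotate = ℕ-solve-∀

  -- Two of the powers m^0, ..., m^q agree modulo q = p^h, and the smaller one cancels because p
  -- does not divide m. The bound u ≤ q enters the choice of parameters.
  order : ∀ h → ∃[ u ] 1 ≤ u × u ≤ p ^ h × + (p ^ h) ∣ + (m ^ u) ℤ.- 1ℤ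
  order h = fromCollision (Fin.pigeonhole (ℕ.n<1+n q) (λ i → fromℕ< (n%ℕd<d (+ (m ^ toℕ i)) q)))
    where
    q = p ^ h
    instance
      q≢0 : NonZero q
      q≢0 = ℕ.m^n≢0 p h {{prime⇒nonZero pp}}
    factor : ∀ {a b} → a ≤ b → + (m ^ b) ℤ.- + (m ^ a) ≡ + (m ^ a) ℤ.* (+ (m ^ (b ∸ a)) ℤ.- 1ℤ)
    factor {a} {b} a≤b = trans (cong (ℤ._- + (m ^ a)) (trans
        (cong +_ (trans (cong (m ^_) (sym (ℕ.m+[n∸m]≡n a≤b))) (ℕ.^-distribˡ-+-* m a (b ∸ a))))
        (ℤ.pos-* (m ^ a) (m ^ (b ∸ a)))))
      (expand (+ (m ^ a)) (+ (m ^ (b ∸ a))))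
      where
      expand : ∀ x y → x ℤ.* y ℤ.- x ≡ x ℤ.* (y ℤ.- 1ℤ)
      expand = solve-∀
    fromCollision : (∃[ i ] ∃[ j ] i Fin.< j ×
      fromℕ< (n%ℕd<d (+ (m ^ toℕ i)) q) ≡ fromℕ< (n%ℕd<d (+ (m ^ toℕ j)) q)) →
      ∃[ u ] 1 ≤ u × u ≤ q × + q ∣ + (m ^ u) ℤ.- 1ℤ
    fromCollision (i , j , i<j , same) = b ∸ a , ℕ.m<n⇒0<n∸m i<j , ℕ.≤-trans (ℕ.m∸n≤m b a) (ℕ.≤-pred (Fin.toℕ<n j)) ,
      ∣ᵤ⇒∣ (p^h∣m^n*y⇒p^h∣y h a (subst (q ℕᵈ.∣_) (ℤ.abs-* (+ (m ^ a)) (+ (m ^ (b ∸ a)) ℤ.- 1ℤ))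
        (∣⇒∣ᵤ (subst (+ q ∣_) (factor (ℕ.<⇒≤ i<j)) (≡-%ℕ⇒∣ {+ (m ^ b)} {+ (m ^ a)} q (sym residues))))))
      where
      a = toℕ i
      b = toℕ j
      residues : (+ (m ^ a)) ℤ.%ℕ q ≡ (+ (m ^ b)) ℤ.%ℕ q
      residues = Fin.fromℕ<-injective _ _ (n%ℕd<d (+ (m ^ a)) q) (n%ℕd<d (+ (m ^ b)) q) same

-- Choice of the parameters and exclusion of long gaps.

-- The constant 42 comes from the pigeonhole condition N (N + I) < g (n + 1) I with N = 6g and I = g.
-- The height q^g of the coefficients, the factor (n+1) g C(t,i) ≤ q^(2g) and the two powers ≤ q^g make q^(5g) < q^N.
module Parameters {p m n D h u : ℕ} (1<p : 1 < p) (1<m : 1 < m) (42≤n : 42 ≤ n) (1≤D : 1 ≤ D) (1≤h : 1 ≤ h)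
  (large : 8 * suc n * (36 * (2 ^ n * (n * (m * D)))) * h ≤ p ^ h)
  (1≤u : 1 ≤ u) (u≤q : u ≤ p ^ h) (q∣m^u-1 : + (p ^ h) ∣ + (m ^ u) ℤ.- 1ℤ) where

  -- With ρ = k / z and g = 2 v ρ, the choice of z gives 6 h g D = ρ z ≤ k, and T gives 2^n g < ρ T.
  -- The grid points are at most 2 e g by the choice of e, D′ controls the powers of B, and k ≥ K
  -- ensures ρ ≥ n.
  q v T z e D′ K : ℕ
  q  = p ^ h
  v  = n * m * u
  T  = suc (2 ^ n * (2 * v))
  z  = 12 * h * v * D
  e  = T * (6 * h * D)
  D′ = 12 * D * (n * (u * T))
  K  = n * z

  instance
    p≢0 : NonZero p
    p≢0 = >-nonZero (ℕ.<⇒≤ 1<p)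
    n≢0 : NonZero n
    n≢0 = >-nonZero (ℕ.≤-trans (s≤s z≤n) 42≤n)
    m≢0 : NonZero m
    m≢0 = >-nonZero (ℕ.<⇒≤ 1<m)
    D≢0 : NonZero D
    D≢0 = >-nonZero 1≤D
    h≢0 : NonZero h
    h≢0 = >-nonZero 1≤h
    u≢0 : NonZero u
    u≢0 = >-nonZero 1≤u
    v≢0 : NonZero v
    v≢0 = ℕ.m*n≢0 (n * m) u {{ℕ.m*n≢0 n m}}
    12h≢0 : NonZero (12 * h)
    12h≢0 = ℕ.m*n≢0 12 h
    12hv≢0 : NonZero (12 * h * v)
    12hv≢0 = ℕ.m*n≢0 (12 * h) v
    z≢0 : NonZero z
    z≢0 = ℕ.m*n≢0 (12 * h * v) D
    12D≢0 : NonZero (12 * D)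
    12D≢0 = ℕ.m*n≢0 12 D
    D′≢0 : NonZero D′
    D′≢0 = ℕ.m*n≢0 (12 * D) (n * (u * T)) {{12D≢0}} {{ℕ.m*n≢0 n (u * T) {{n≢0}} {{ℕ.m*n≢0 u T}}}}
    6h≢0 : NonZero (6 * h)
    6h≢0 = ℕ.m*n≢0 6 h
    6hD≢0 : NonZero (6 * h * D)
    6hD≢0 = ℕ.m*n≢0 (6 * h) D
    e≢0 : NonZero e
    e≢0 = ℕ.m*n≢0 T (6 * h * D)
    q≢0 : NonZero q
    q≢0 = ℕ.m^n≢0 p h

  1<q : 1 < q
  1<q = ℕ.^-monoʳ-< p 1<p {0} {h} 1≤h

  -- The g-th power of the left side bounds (n + 1) g C(t, i). As T ≤ 3 2^n v, the product is at
  -- most the left side of `large` times u, and both factors are at most q.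
  base≤q² : suc n * 2 * (4 * (2 * e)) ≤ q * q
  base≤q² = begin
    suc n * 2 * (4 * (2 * (T * (6 * h * D))))                                   ≤⟨ ℕ.*-monoʳ-≤ (suc n * 2) (ℕ.*-monoʳ-≤ 4 (ℕ.*-monoʳ-≤ 2 (ℕ.*-monoˡ-≤ (6 * h * D) T≤))) ⟩
    suc n * 2 * (4 * (2 * (3 * (2 ^ n * v) * (6 * h * D))))                      ≡⟨ regroup n (2 ^ n) m u h D ⟩
    8 * suc n * (36 * (2 ^ n * (n * (m * D)))) * h * u                           ≤⟨ ℕ.*-mono-≤ large u≤q ⟩
    q * q ∎
    where
    open ℕ.≤-Reasoning
    T≤ : T ≤ 3 * (2 ^ n * v)
    T≤ = begin
      1 + 2 ^ n * (2 * v)            ≤⟨ ℕ.+-monoˡ-≤ (2 ^ n * (2 * v)) (ℕ.*-mono-≤ (ℕ.m^n>0 2 n) (>-nonZero⁻¹ v)) ⟩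
      2 ^ n * v + 2 ^ n * (2 * v)    ≡⟨ triple (2 ^ n) v ⟩
      3 * (2 ^ n * v)                ∎
      where
      triple : ∀ a v → a * v + a * (2 * v) ≡ 3 * (a * v)
      triple = ℕ-solve-∀
    regroup : ∀ n a m u h D → suc n * 2 * (4 * (2 * (3 * (a * (n * m * u)) * (6 * h * D)))) ≡
      8 * suc n * (36 * (a * (n * (m * D)))) * h * u
    regroup = ℕ-solve-∀

  module _ {k B f f′ : ℕ} (K≤k : K ≤ k) (1≤B : 1 ≤ B) (B<p^f′ : B < p ^ f′) (f′D′≤k : f′ * D′ ≤ k) (k≤Df : k ≤ D * f)
    (p^f∣ : + (p ^ f) ∣ + (m ^ k) ℤ.- + B) where

    ρ g Y : ℕ
    ρ = k / z
    g = 2 * v * ρ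
    Y = (4 * (2 * e)) ^ g * (q ^ g * q ^ g)

    n≤ρ : n ≤ ρ
    n≤ρ = ℕ.≤-trans (ℕ.≤-reflexive (sym (m*n/n≡m n z))) (/-monoˡ-≤ z K≤k)

    ρz≤k : ρ * z ≤ k
    ρz≤k = m/n*n≤m k z

    instance
      ρ≢0 : NonZero ρ
      ρ≢0 = >-nonZero (ℕ.≤-trans (>-nonZero⁻¹ n) n≤ρ)
      2v≢0 : NonZero (2 * v)
      2v≢0 = ℕ.m*n≢0 2 v
      g≢0 : NonZero g
      g≢0 = ℕ.m*n≢0 (2 * v) ρ
      gg≢0 : NonZero (g * g)
      gg≢0 = ℕ.m*n≢0 g g

    -- Rounding k down to ρ z loses at most a factor 2, because ρ ≥ 1.
    k≤12hDg : k ≤ 12 * D * (h * g)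
    k≤12hDg = begin
      k                      ≡⟨ m≡m%n+[m/n]*n k z ⟩
      k % z + ρ * z          ≤⟨ ℕ.+-monoˡ-≤ (ρ * z) (ℕ.<⇒≤ (m%n<n k z)) ⟩
      z + ρ * z              ≤⟨ ℕ.+-monoˡ-≤ (ρ * z) (ℕ.m≤n*m z ρ) ⟩
      ρ * z + ρ * z          ≡⟨ regroup ρ h v D ⟩
      12 * D * (h * g)       ∎
      where
      open ℕ.≤-Reasoning
      regroup : ∀ ρ h v D → ρ * (12 * h * v * D) + ρ * (12 * h * v * D) ≡ 12 * D * (h * (2 * v * ρ))
      regroup = ℕ-solve-∀

    6hg≤f : h * (6 * g) ≤ f
    6hg≤f = ℕ.*-cancelˡ-≤ D (begin
      D * (h * (6 * g))      ≡⟨ regroup ρ h v D ⟩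
      ρ * z                  ≤⟨ ρz≤k ⟩
      k                      ≤⟨ k≤Df ⟩
      D * f                  ∎)
      where
      open ℕ.≤-Reasoning
      regroup : ∀ ρ h v D → D * (h * (6 * (2 * v * ρ))) ≡ ρ * (12 * h * v * D)
      regroup = ℕ-solve-∀

    f′unT≤hg : f′ * (u * n * T) ≤ h * g
    f′unT≤hg = ℕ.*-cancelˡ-≤ (12 * D) (begin
      12 * D * (f′ * (u * n * T))        ≡⟨ regroup D f′ u n T ⟩
      f′ * D′                            ≤⟨ f′D′≤k ⟩
      k                                  ≤⟨ k≤12hDg ⟩
      12 * D * (h * g)                   ∎)
      where
      open ℕ.≤-Reasoning
      regroup : ∀ D f′ u n T → 12 * D * (f′ * (u * n * T)) ≡ f′ * (12 * D * (n * (u * T)))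
      regroup = ℕ-solve-∀

    many : (q ^ (6 * g)) ^ (6 * g + g) < (q ^ g) ^ (suc n * g)
    many = begin-strict
      (q ^ (6 * g)) ^ (6 * g + g)      ≡⟨ ℕ.^-*-assoc q (6 * g) (6 * g + g) ⟩
      q ^ (6 * g * (6 * g + g))        <⟨ ℕ.^-monoʳ-< q 1<q exponents ⟩
      q ^ (g * (suc n * g))            ≡⟨ ℕ.^-*-assoc q g (suc n * g) ⟨
      (q ^ g) ^ (suc n * g)            ∎
      where
      open ℕ.≤-Reasoning
      expand : ∀ g → 6 * g * (6 * g + g) ≡ 42 * (g * g)
      expand = ℕ-solve-∀
      collect : ∀ n g → n * (g * g) + g * g ≡ g * (suc n * g)
      collect = ℕ-solve-∀
      exponents : 6 * g * (6 * g + g) < g * (suc n * g)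
      exponents = begin-strict
        6 * g * (6 * g + g)     ≡⟨ expand g ⟩
        42 * (g * g)            ≤⟨ ℕ.*-monoˡ-≤ (g * g) 42≤n ⟩
        n * (g * g)             <⟨ ℕ.m<m+n (n * (g * g)) (>-nonZero⁻¹ (g * g)) ⟩
        n * (g * g) + g * g     ≡⟨ collect n g ⟩
        g * (suc n * g)         ∎

    r≤2ρ : ∀ {r} → r < n + ρ → r ≤ 2 * ρ
    r≤2ρ {r} r< = begin
      r              ≤⟨ ℕ.<⇒≤ r< ⟩
      n + ρ          ≤⟨ ℕ.+-monoˡ-≤ ρ n≤ρ ⟩
      ρ + ρ          ≡⟨ cong (λ x → ρ + x) (ℕ.+-identityʳ ρ) ⟨
      2 * ρ          ∎
      where open ℕ.≤-Reasoning

    2ρ≤k : 2 * ρ ≤ k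
    2ρ≤k = begin
      2 * ρ            ≡⟨ ℕ.*-comm 2 ρ ⟩
      ρ * 2            ≤⟨ ℕ.*-monoʳ-≤ ρ 2≤z ⟩
      ρ * z            ≤⟨ ρz≤k ⟩
      k                ∎
      where
      open ℕ.≤-Reasoning
      2≤z : 2 ≤ z
      2≤z = begin
        2                  ≤⟨ s≤s (s≤s z≤n) ⟩
        12                 ≤⟨ ℕ.m≤m*n 12 h ⟩
        12 * h             ≤⟨ ℕ.m≤m*n (12 * h) v ⟩
        12 * h * v         ≤⟨ ℕ.m≤m*n (12 * h * v) D ⟩
        z                  ∎

    point≤ : ∀ {r s} → r < n + ρ → s < T → r + s * k ≤ 2 * e * g
    point≤ {r} {s} r< s<T = begin
      r + s * k                   ≤⟨ ℕ.+-monoˡ-≤ (s * k) (ℕ.≤-trans (r≤2ρ r<) 2ρ≤k) ⟩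
      suc s * k                   ≤⟨ ℕ.*-mono-≤ s<T k≤12hDg ⟩
      T * (12 * D * (h * g))      ≡⟨ regroup T D h g ⟩
      2 * e * g                   ∎
      where
      open ℕ.≤-Reasoning
      regroup : ∀ T D h g → T * (12 * D * (h * g)) ≡ 2 * (T * (6 * h * D)) * g
      regroup = ℕ-solve-∀

    tower : ∀ x a j r → ((x ^ a) ^ j) ^ r ≡ x ^ (a * j * r)
    tower x a j r = trans (cong (_^ r) (ℕ.^-*-assoc x a j)) (ℕ.^-*-assoc x (a * j) r)

    size : ∀ {r s i j} → r < n + ρ → s < T → i < g → j ≤ n →
      ((r + s * k) C i) * (((m ^ u) ^ j) ^ r * ((B ^ u) ^ j) ^ s) ≤ Y
    size {r} {s} {i} {j} r< s<T i<g j≤n =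
      ℕ.*-mono-≤ (C-bound {e} (point≤ r< s<T) (ℕ.<⇒≤ i<g)) (ℕ.*-mono-≤ m-part B-part)
      where
      open ℕ.≤-Reasoning
      m-part : ((m ^ u) ^ j) ^ r ≤ q ^ g
      m-part = begin
        ((m ^ u) ^ j) ^ r           ≡⟨ tower m u j r ⟩
        -- The crude bound m ≤ 2^m ≤ p^m converts to powers of p and accounts for the factor m in
        -- `v`.
        m ^ (u * j * r)             ≤⟨ ℕ.^-monoˡ-≤ (u * j * r) (ℕ.≤-trans (ℕ.<⇒≤ (n<2^n m)) (ℕ.^-monoˡ-≤ m 1<p)) ⟩
        (p ^ m) ^ (u * j * r)       ≡⟨ ℕ.^-*-assoc p m (u * j * r) ⟩
        p ^ (m * (u * j * r))       ≤⟨ ℕ.^-monoʳ-≤ p exponent ⟩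
        p ^ (h * g)                 ≡⟨ ℕ.^-*-assoc p h g ⟨
        q ^ g                       ∎
        where
        regroup : ∀ m u n ρ → m * (u * n * (2 * ρ)) ≡ 2 * (n * m * u) * ρ
        regroup = ℕ-solve-∀
        exponent : m * (u * j * r) ≤ h * g
        exponent = begin
          m * (u * j * r)           ≤⟨ ℕ.*-monoʳ-≤ m (ℕ.*-mono-≤ (ℕ.*-monoʳ-≤ u j≤n) (r≤2ρ r<)) ⟩
          m * (u * n * (2 * ρ))     ≡⟨ regroup m u n ρ ⟩
          g                         ≤⟨ ℕ.m≤n*m g h ⟩
          h * g                     ∎
      B-part : ((B ^ u) ^ j) ^ s ≤ q ^ g
      B-part = begin
        ((B ^ u) ^ j) ^ s           ≡⟨ tower B u j s ⟩
        B ^ (u * j * s)             ≤⟨ ℕ.^-monoˡ-≤ (u * j * s) (ℕ.<⇒≤ B<p^f′) ⟩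
        (p ^ f′) ^ (u * j * s)      ≡⟨ ℕ.^-*-assoc p f′ (u * j * s) ⟩
        p ^ (f′ * (u * j * s))      ≤⟨ ℕ.^-monoʳ-≤ p (ℕ.≤-trans
                                         (ℕ.*-monoʳ-≤ f′ (ℕ.*-mono-≤ (ℕ.*-monoʳ-≤ u j≤n) (ℕ.<⇒≤ s<T))) f′unT≤hg) ⟩
        p ^ (h * g)                 ≡⟨ ℕ.^-*-assoc p h g ⟨
        q ^ g                       ∎

    small : suc n * g * (q ^ g * Y) < q ^ (6 * g)
    small = begin-strict
      -- Both n + 1 ≤ (n + 1)^g and g ≤ 2^g are wasteful, but turn all factors into g-th powers.
      suc n * g * (G * (E ^ g * (G * G)))                ≤⟨ ℕ.*-monoˡ-≤ (G * (E ^ g * (G * G))) (ℕ.*-mono-≤ 1+n≤ (ℕ.<⇒≤ (n<2^n g))) ⟩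
      suc n ^ g * 2 ^ g * (G * (E ^ g * (G * G)))        ≡⟨ cong (_* (G * (E ^ g * (G * G)))) (^-distribʳ-* (suc n) 2 g) ⟨
      (suc n * 2) ^ g * (G * (E ^ g * (G * G)))          ≡⟨ regroup ((suc n * 2) ^ g) G (E ^ g) ⟩
      (suc n * 2) ^ g * E ^ g * (G * (G * G))            ≡⟨ cong (_* (G * (G * G))) (^-distribʳ-* (suc n * 2) E g) ⟨
      (suc n * 2 * E) ^ g * (G * (G * G))                ≤⟨ ℕ.*-monoˡ-≤ (G * (G * G)) (ℕ.^-monoˡ-≤ g base≤q²) ⟩
      (q * q) ^ g * (G * (G * G))                        ≡⟨ cong (_* (G * (G * G))) (^-distribʳ-* q q g) ⟩
      G * G * (G * (G * G))                              ≡⟨ five G ⟩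
      G ^ 5                                              <⟨ ℕ.^-monoʳ-< G 1<G {5} {6} ℕ.≤-refl ⟩
      G ^ 6                                              ≡⟨ ℕ.^-*-assoc q g 6 ⟩
      q ^ (g * 6)                                        ≡⟨ cong (q ^_) (ℕ.*-comm g 6) ⟩
      q ^ (6 * g)                                        ∎
      where
      open ℕ.≤-Reasoning
      G = q ^ g
      E = 4 * (2 * e)
      1<G : 1 < G
      1<G = ℕ.^-monoʳ-< q 1<q {0} {g} (>-nonZero⁻¹ g)
      1+n≤ : suc n ≤ suc n ^ g
      1+n≤ = ℕ.≤-trans (ℕ.≤-reflexive (sym (ℕ.^-identityʳ (suc n)))) (ℕ.^-monoʳ-≤ (suc n) (>-nonZero⁻¹ g))
      regroup : ∀ a G b → a * (G * (b * (G * G))) ≡ a * b * (G * (G * G))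
      regroup = ℕ-solve-∀
      five : ∀ G → G * G * (G * (G * G)) ≡ G * (G * (G * (G * (G * 1))))
      five = ℕ-solve-∀

    -- The congruence m^k ≡ B modulo p^f is raised to the power u; p^f is a multiple of q^(6g) by
    -- `6hg≤f`.
    q^6g∣ : (+ q) ℤ.^ (6 * g) ∣ (+ (m ^ u)) ℤ.^ k ℤ.- + (B ^ u)
    q^6g∣ = subst₂ (λ x y → x ∣ y) (trans (cong +_ (sym (ℕ.^-*-assoc p h (6 * g)))) (pos-^ q (6 * g)))
      (cong₂ ℤ._-_ powers (sym (pos-^ B u)))
      (∣-trans (∣ᵤ⇒∣ (ℕᵈ.divides (p ^ (f ∸ h * (6 * g))) split)) (^-cong-∣ u p^f∣))
      where
      split : p ^ f ≡ p ^ (f ∸ h * (6 * g)) * p ^ (h * (6 * g))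
      split = trans (cong (p ^_) (sym (ℕ.m∸n+n≡m 6hg≤f))) (ℕ.^-distribˡ-+-* p (f ∸ h * (6 * g)) (h * (6 * g)))
      powers : (+ (m ^ k)) ℤ.^ u ≡ (+ (m ^ u)) ℤ.^ k
      powers = trans (sym (pos-^ (m ^ k) u)) (trans
        (cong +_ (trans (ℕ.^-*-assoc m k u) (trans (cong (m ^_) (ℕ.*-comm k u)) (sym (ℕ.^-*-assoc m u k)))))
        (pos-^ (m ^ u) k))

    2^n*g<ρ*T : 2 ^ n * g < ρ * T
    2^n*g<ρ*T = begin-strict
      2 ^ n * g                       <⟨ ℕ.m<m+n (2 ^ n * g) (>-nonZero⁻¹ ρ) ⟩
      2 ^ n * g + ρ                   ≡⟨ regroup (2 ^ n) v ρ ⟩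
      ρ * T                           ∎
      where
      open ℕ.≤-Reasoning
      regroup : ∀ a v ρ → a * (2 * v * ρ) + ρ ≡ ρ * suc (a * (2 * v))
      regroup = ℕ-solve-∀

    absurd : ⊥
    absurd = Interpolation.contradictory {m ^ u} {B ^ u} {k} {q} {6 * g} {g} {n} {q ^ g} {ρ} {T} {Y}
      (ℕ.^-monoʳ-< m 1<m {0} {u} 1≤u) (ℕ.m^n>0 B {{>-nonZero 1≤B}} u) q∣m^u-1 q^6g∣ many size small
      (ℕ.≤-trans (ℕ.m≤n*m ρ 2) 2ρ≤k) 2^n*g<ρ*T

-- Under the excluded congruence the base-p digits of m^k would be zero from position f′ ≤ k/D′ up
-- to f - 1, where f ≥ k/D.
GapBound : (p m D D′ K : ℕ) → Set
GapBound p m D D′ K = ∀ {k B} f f′ → K ≤ k → 1 ≤ B → B < p ^ f′ → f′ * D′ ≤ k → k ≤ D * f →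
  ¬ (+ (p ^ f) ∣ + (m ^ k) ℤ.- + B)

gap-bound : ∀ {p m} → Prime p → ¬ (p ℕᵈ.∣ m) → 1 < m → ∀ D → 1 ≤ D →
  ∃[ D′ ] ∃[ K ] 1 ≤ D′ × GapBound p m D D′ K
gap-bound {p} {m} pp p∤m 1<m D 1≤D = go 42 ℕ.≤-refl
  where
  1<p : 1 < p
  1<p = nonTrivial⇒n>1 p {{prime⇒nonTrivial pp}}
  -- n is a variable here so that 2 ^ n is never evaluated.
  go : ∀ n → 42 ≤ n → ∃[ D′ ] ∃[ K ] 1 ≤ D′ × GapBound p m D D′ K
  go n 42≤n = conclude (order pp p∤m h)
    where
    c h : ℕ
    c = 8 * suc n * (36 * (2 ^ n * (n * (m * D))))
    -- The constant c is the factor of h in `large` and does not depend on h, so `c*h≤p^h` settles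
    -- that condition.
    h = 2 * c
    1≤c : 1 ≤ c
    1≤c = ℕ.*-mono-≤ (ℕ.*-mono-≤ {1} {8} {1} {suc n} (s≤s z≤n) (s≤s z≤n))
            (ℕ.*-mono-≤ {1} {36} (s≤s z≤n) (ℕ.*-mono-≤ (ℕ.m^n>0 2 n)
              (ℕ.*-mono-≤ (ℕ.≤-trans (s≤s z≤n) 42≤n) (ℕ.*-mono-≤ (ℕ.<⇒≤ 1<m) 1≤D))))
    conclude : (∃[ u ] 1 ≤ u × u ≤ p ^ h × + (p ^ h) ∣ + (m ^ u) ℤ.- 1ℤ) →
      ∃[ D′ ] ∃[ K ] 1 ≤ D′ × GapBound p m D D′ K
    conclude (u , 1≤u , u≤q , q∣) = D′ , K , >-nonZero⁻¹ D′ , λ {k} {B} f f′ → absurd {k} {B} {f} {f′}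
      where open Parameters 1<p 1<m 42≤n 1≤D (ℕ.*-mono-≤ {1} {2} (s≤s z≤n) 1≤c) (c*h≤p^h 1<p c) 1≤u u≤q q∣

-- Fractional parts and base-p digits.

toℚᵘ-/ : ∀ i d .{{_ : NonZero d}} → toℚᵘ (i ℚ./ d) ℚᵘ.≃ (i ℚᵘ./ d)
toℚᵘ-/ i (suc d) = ℚ.toℚᵘ-fromℚᵘ (mkℚᵘ i d)

*≤*⇒/≤/ : ∀ a b c d .{{_ : NonZero b}} .{{_ : NonZero d}} → a ℤ.* + d ℤ.≤ c ℤ.* + b → a ℚ./ b ℚ.≤ c ℚ./ d
*≤*⇒/≤/ a (suc b) c (suc d) le = ℚ.toℚᵘ-cancel-≤
  (ℚᵘ.≤-respˡ-≃ (ℚᵘ.≃-sym (toℚᵘ-/ a (suc b))) (ℚᵘ.≤-respʳ-≃ (ℚᵘ.≃-sym (toℚᵘ-/ c (suc d))) (*≤* le)))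

/≤/⇒*≤* : ∀ a b c d .{{_ : NonZero b}} .{{_ : NonZero d}} → a ℚ./ b ℚ.≤ c ℚ./ d → a ℤ.* + d ℤ.≤ c ℤ.* + b
/≤/⇒*≤* a (suc b) c (suc d) le with *≤* le′ ←
  ℚᵘ.≤-respˡ-≃ (toℚᵘ-/ a (suc b)) (ℚᵘ.≤-respʳ-≃ (toℚᵘ-/ c (suc d)) (ℚ.toℚᵘ-mono-≤ le)) = le′

/-cross : ∀ a b c d .{{_ : NonZero b}} .{{_ : NonZero d}} → a ℤ.* + d ≡ c ℤ.* + b → a ℚ./ b ≡ c ℚ./ d
/-cross a b c d eq = ℚ.≤-antisym (*≤*⇒/≤/ a b c d (ℤ.≤-reflexive eq)) (*≤*⇒/≤/ c d a b (ℤ.≤-reflexive (sym eq)))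

/+/ : ∀ a b c d .{{_ : NonZero b}} .{{_ : NonZero d}} .{{_ : NonZero (b * d)}} →
  a ℚ./ b ℚ.+ c ℚ./ d ≡ (a ℤ.* + d ℤ.+ c ℤ.* + b) ℚ./ (b * d)
/+/ a (suc b) c (suc d) = ℚ.toℚᵘ-injective (ℚᵘ.≃-trans (ℚ.toℚᵘ-homo-+ (a ℚ./ suc b) (c ℚ./ suc d))
  (ℚᵘ.≃-trans (ℚᵘ.+-cong (toℚᵘ-/ a (suc b)) (toℚᵘ-/ c (suc d))) (ℚᵘ.≃-sym (toℚᵘ-/ (a ℤ.* + suc d ℤ.+ c ℤ.* + suc b) (suc b * suc d)))))

floor≤ : ∀ x → floor x ℚ./ 1 ℚ.≤ x
floor≤ x@(mkℚ n d _) = ℚ.toℚᵘ-cancel-≤ (ℚᵘ.≤-respˡ-≃ (ℚᵘ.≃-sym (toℚᵘ-/ (floor x) 1))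
  (*≤* (subst (floor x ℤ.* + suc d ℤ.≤_) (sym (ℤ.*-identityʳ n)) (ℤ.[n/d]*d≤n n (+ suc d)))))

y+floor≤⇒y≤frac : ∀ {y} x → y ℚ.+ floor x ℚ./ 1 ℚ.≤ x → y ℚ.≤ frac x
y+floor≤⇒y≤frac {y} x le = subst (ℚ._≤ frac x) cancel (ℚ.+-monoˡ-≤ (ℚ.- z) le)
  where
  z = floor x ℚ./ 1
  cancel : y ℚ.+ z ℚ.- z ≡ y
  cancel = trans (ℚ.+-assoc y z (ℚ.- z)) (trans (cong (y ℚ.+_) (ℚ.+-inverseʳ z)) (ℚ.+-identityʳ y))

0≤frac : ∀ x → 0ℚ ℚ.≤ frac x
0≤frac x = y+floor≤⇒y≤frac x (subst (ℚ._≤ x) (sym (ℚ.+-identityˡ _)) (floor≤ x))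

-- The hypothesis says that digit ν of N is nonzero. Writing N = r + Q p^(ν+1), the bound floor x ≤
-- Q suffices; it follows from floor x ≤ x < Q + 1.
1/p≤frac : ∀ N p ν .{{_ : NonZero p}} .{{_ : NonZero (p ^ suc ν)}} → p ^ ν ≤ N % p ^ suc ν →
  1ℤ ℚ./ p ℚ.≤ frac (+ N ℚ./ (p ^ suc ν))
1/p≤frac N p ν p^ν≤ = y+floor≤⇒y≤frac x (subst (ℚ._≤ x) (sym (/+/ 1ℤ p z 1)) (*≤*⇒/≤/ (1ℤ ℤ.* + 1 ℤ.+ z ℤ.* + p) (p * 1) (+ N) d below))
  where
  instance
    p1≢0 : NonZero (p * 1)
    p1≢0 = ℕ.m*n≢0 p 1
    d≢0 : ℤ.Positive (+ (p ^ suc ν))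
    d≢0 = ℤ.positive (ℤ.+<+ (>-nonZero⁻¹ (p ^ suc ν)))
  d = p ^ suc ν
  x = + N ℚ./ d
  z = floor x
  Q = N / d
  N≡ : + N ≡ + (N % d) ℤ.+ + Q ℤ.* + d
  N≡ = trans (cong +_ (m≡m%n+[m/n]*n N d)) (trans (ℤ.pos-+ (N % d) (Q * d)) (cong (λ y → + (N % d) ℤ.+ y) (ℤ.pos-* Q d)))
  zd≤N : z ℤ.* + d ℤ.≤ + N
  zd≤N = subst (z ℤ.* + d ℤ.≤_) (ℤ.*-identityʳ (+ N)) (/≤/⇒*≤* z 1 (+ N) d (floor≤ x))
  N<[1+Q]d : N < suc Q * d
  N<[1+Q]d = subst (_< suc Q * d) (sym (m≡m%n+[m/n]*n N d)) (ℕ.+-monoˡ-< (Q * d) (m%n<n N d))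
  z<1+Q : z ℤ.< + suc Q
  z<1+Q = ℤ.*-cancelʳ-<-nonNeg (+ d) (ℤ.≤-<-trans zd≤N (subst (+ N ℤ.<_) (ℤ.pos-* (suc Q) d) (ℤ.+<+ N<[1+Q]d)))
  <suc⇒≤ : ∀ {i n} → i ℤ.< + suc n → i ℤ.≤ + n
  <suc⇒≤ (ℤ.+<+ (s≤s le)) = ℤ.+≤+ le
  <suc⇒≤ ℤ.-<+           = ℤ.-≤+
  below : (1ℤ ℤ.* + 1 ℤ.+ z ℤ.* + p) ℤ.* + d ℤ.≤ + N ℤ.* + (p * 1)
  below = begin
    (1ℤ ℤ.* + 1 ℤ.+ z ℤ.* + p) ℤ.* + d           ≡⟨ cong (λ y → (1ℤ ℤ.* + 1 ℤ.+ z ℤ.* + p) ℤ.* y) (ℤ.pos-* p (p ^ ν)) ⟩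
    (1ℤ ℤ.* + 1 ℤ.+ z ℤ.* + p) ℤ.* (+ p ℤ.* π)   ≡⟨ regroup z (+ p) π ⟩
    (π ℤ.+ z ℤ.* (+ p ℤ.* π)) ℤ.* + p            ≡⟨ cong (λ y → (π ℤ.+ z ℤ.* y) ℤ.* + p) (ℤ.pos-* p (p ^ ν)) ⟨
    (π ℤ.+ z ℤ.* + d) ℤ.* + p                    ≤⟨ ℤ.*-monoʳ-≤-nonNeg (+ p) (ℤ.+-mono-≤ (ℤ.+≤+ p^ν≤) (ℤ.*-monoʳ-≤-nonNeg (+ d) (<suc⇒≤ z<1+Q))) ⟩
    (+ (N % d) ℤ.+ + Q ℤ.* + d) ℤ.* + p          ≡⟨ cong₂ (λ y y′ → y ℤ.* + y′) N≡ (ℕ.*-identityʳ p) ⟨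
    + N ℤ.* + (p * 1)                            ∎
    where
    open ℤ.≤-Reasoning
    π = + (p ^ ν)
    regroup : ∀ z p π → (1ℤ ℤ.* 1ℤ ℤ.+ z ℤ.* p) ℤ.* (p ℤ.* π) ≡ (π ℤ.+ z ℤ.* (p ℤ.* π)) ℤ.* p
    regroup = solve-∀

-- Induction on f. Up to f′ the residue is below p^f′ trivially; after that, a zero digit at
-- position f leaves the residue unchanged from modulus p^f to p^(f+1).
digit-in-window : ∀ N p f′ f .{{_ : NonZero p}} →
  (∃[ ν ] f′ ≤ ν × ν < f × p ^ ν ≤ (N % p ^ suc ν) {{ℕ.m^n≢0 p (suc ν)}}) ⊎
  (N % p ^ f) {{ℕ.m^n≢0 p f}} < p ^ f′
digit-in-window N p f′ zero = inj₂ (ℕ.<-≤-trans (m%n<n N 1) (ℕ.m^n>0 p f′))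
digit-in-window N p f′ (suc f) with digit-in-window N p f′ f
... | inj₁ (ν , f′≤ν , ν<f , le) = inj₁ (ν , f′≤ν , ℕ.m≤n⇒m≤1+n ν<f , le)
... | inj₂ small with ℕ.<-≤-connex f f′
...   | inj₁ f<f′ = inj₂ (ℕ.<-≤-trans (m%n<n N (p ^ suc f) {{ℕ.m^n≢0 p (suc f)}}) (ℕ.^-monoʳ-≤ p f<f′))
...   | inj₂ f′≤f with ℕ.<-≤-connex ((N % p ^ suc f) {{ℕ.m^n≢0 p (suc f)}}) (p ^ f)
...     | inj₂ le = inj₁ (f , f′≤f , ℕ.≤-refl , le)
...     | inj₁ lt = inj₂ (subst (_< p ^ f′) (sym same) small)
  where
  instance
    p^f≢0 : NonZero (p ^ f)
    p^f≢0 = ℕ.m^n≢0 p f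
    p^1+f≢0 : NonZero (p ^ suc f)
    p^1+f≢0 = ℕ.m^n≢0 p (suc f)
  same : N % p ^ suc f ≡ N % p ^ f
  same = trans (sym (m<n⇒m%n≡m lt)) (m∣n⇒o%n%m≡o%m (p ^ f) (p ^ suc f) N (ℕᵈ.n∣m*n p))

d∣N-N%d : ∀ N d .{{_ : NonZero d}} → + d ∣ + N ℤ.- + (N % d)
d∣N-N%d N d = divides (+ (N / d)) (trans
  (cong (λ y → y ℤ.- + (N % d)) (trans (cong +_ (m≡m%n+[m/n]*n N d)) (ℤ.pos-+ (N % d) (N / d * d))))
  (trans (cancel (+ (N % d)) (+ (N / d * d))) (ℤ.pos-* (N / d) d)))
  where
  cancel : ∀ x y → x ℤ.+ y ℤ.- x ≡ y
  cancel = solve-∀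

-- Partial sums: monotonicity and removal of the factor p^a.

module _ (n p : ℕ) (pp : Prime p) (k : ℕ) where

  partialSum-step : ∀ V → partialSum n p pp k V ℚ.≤ partialSum n p pp k (suc V)
  partialSum-step V = subst (ℚ._≤ partialSum n p pp k (suc V)) (ℚ.+-identityʳ _)
    (ℚ.+-monoʳ-≤ (partialSum n p pp k V) (0≤frac (term n p pp k (suc V))))

  partialSum-mono : ∀ {V W} → V ≤ W → partialSum n p pp k V ℚ.≤ partialSum n p pp k W
  partialSum-mono = go ∘ ℕ.≤⇒≤′
    where
    go : ∀ {V W} → V ≤′ W → partialSum n p pp k V ℚ.≤ partialSum n p pp k W
    go ≤′-refl       = ℚ.≤-refl
    go (≤′-step {W} V≤W) = ℚ.≤-trans (go V≤W) (partialSum-step W)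

  0≤partialSum : ∀ V → 0ℚ ℚ.≤ partialSum n p pp k V
  0≤partialSum V = partialSum-mono {0} {V} z≤n

-- Multiplying m by p^a moves the terms by a k places, since (p^a m)^k / p^(ak+ν) = m^k / p^ν; the a
-- k new terms in front are nonnegative.
partialSum-p^a*m : ∀ a m p (pp : Prime p) k V → partialSum m p pp k V ℚ.≤ partialSum (p ^ a * m) p pp k (a * k + V)
partialSum-p^a*m a m p pp k zero    = 0≤partialSum (p ^ a * m) p pp k (a * k + 0)
partialSum-p^a*m a m p pp k (suc V) = subst (partialSum m p pp k (suc V) ℚ.≤_)
  (cong (partialSum (p ^ a * m) p pp k) (sym (ℕ.+-suc (a * k) V)))
  (ℚ.+-mono-≤ (partialSum-p^a*m a m p pp k V) (ℚ.≤-reflexive (cong frac (/-cross (+ (m ^ k)) (p ^ suc V) (+ ((p ^ a * m) ^ k)) (p ^ suc (a * k + V)) (begin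
    + (m ^ k) ℤ.* + (p ^ suc (a * k + V))          ≡⟨ ℤ.pos-* (m ^ k) (p ^ suc (a * k + V)) ⟨
    + (m ^ k * p ^ suc (a * k + V))                ≡⟨ cong +_ cross ⟩
    + ((p ^ a * m) ^ k * p ^ suc V)                ≡⟨ ℤ.pos-* ((p ^ a * m) ^ k) (p ^ suc V) ⟩
    + ((p ^ a * m) ^ k) ℤ.* + (p ^ suc V)          ∎)))))
  where
  open ≡-Reasoning
  instance
    p≢0 : NonZero p
    p≢0 = prime⇒nonZero pp
    p^1+V≢0 : NonZero (p ^ suc V)
    p^1+V≢0 = ℕ.m^n≢0 p (suc V)
    p^ak+V≢0 : NonZero (p ^ suc (a * k + V))
    p^ak+V≢0 = ℕ.m^n≢0 p (suc (a * k + V))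
  regroup : ∀ x y z p → x * (p * (y * z)) ≡ y * x * (p * z)
  regroup = ℕ-solve-∀
  cross : m ^ k * p ^ suc (a * k + V) ≡ (p ^ a * m) ^ k * p ^ suc V
  cross = begin
    m ^ k * (p * p ^ (a * k + V))            ≡⟨ cong (λ y → m ^ k * (p * y)) (ℕ.^-distribˡ-+-* p (a * k) V) ⟩
    m ^ k * (p * (p ^ (a * k) * p ^ V))      ≡⟨ regroup (m ^ k) (p ^ (a * k)) (p ^ V) p ⟩
    p ^ (a * k) * m ^ k * p ^ suc V          ≡⟨ cong (λ y → y * m ^ k * p ^ suc V) (ℕ.^-*-assoc p a k) ⟨
    (p ^ a) ^ k * m ^ k * p ^ suc V          ≡⟨ cong (_* p ^ suc V) (^-distribʳ-* (p ^ a) m k) ⟨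
    (p ^ a * m) ^ k * p ^ suc V              ∎

-- Growth of the sum and divergence.

+1/ : ∀ S p .{{_ : NonZero p}} → + S ℚ./ p ℚ.+ 1ℤ ℚ./ p ≡ + suc S ℚ./ p
+1/ S p = trans (/+/ (+ S) p 1ℤ p) (/-cross (+ S ℤ.* + p ℤ.+ 1ℤ ℤ.* + p) (p * p) (+ suc S) p (regroup (+ S) (+ p) (+ (p * p)) (+ suc S) (ℤ.pos-* p p) refl))
  where
  instance
    pp≢0 : NonZero (p * p)
    pp≢0 = ℕ.m*n≢0 p p
  expand : ∀ s p → (s ℤ.* p ℤ.+ 1ℤ ℤ.* p) ℤ.* p ≡ (1ℤ ℤ.+ s) ℤ.* (p ℤ.* p)
  expand = solve-∀
  regroup : ∀ s p pp s′ → pp ≡ p ℤ.* p → s′ ≡ 1ℤ ℤ.+ s → (s ℤ.* p ℤ.+ 1ℤ ℤ.* p) ℤ.* p ≡ s′ ℤ.* pp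
  regroup s p _ _ refl refl = expand s p

archimedean : ∀ p .{{_ : NonZero p}} (M : ℚ) → ∃[ S ] M <ℚ + S ℚ./ p
archimedean p M@(mkℚ n d _) = S , ℚ.toℚᵘ-cancel-< (ℚᵘ.<-respʳ-≃ (ℚᵘ.≃-sym (toℚᵘ-/ (+ S) p)) (below p refl))
  where
  -- This makes S / p = |n| + 1, which exceeds the numerator of M and hence M.
  S = suc ∣ n ∣ * p
  below : ∀ p′ .{{_ : NonZero p′}} → p′ ≡ p → mkℚᵘ n d ℚᵘ.< (+ S ℚᵘ./ p′)
  below (suc p′) refl = *<* (begin-strict
    n ℤ.* + suc p′                     ≤⟨ ℤ.*-monoʳ-≤-nonNeg (+ suc p′) (i≤+∣i∣ n) ⟩
    + ∣ n ∣ ℤ.* + suc p′               ≡⟨ ℤ.pos-* ∣ n ∣ (suc p′) ⟨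
    + (∣ n ∣ * suc p′)                 <⟨ ℤ.+<+ (ℕ.*-monoˡ-< (suc p′) (ℕ.n<1+n ∣ n ∣)) ⟩
    + (suc ∣ n ∣ * suc p′)             ≤⟨ ℤ.+≤+ (ℕ.m≤m*n (suc ∣ n ∣ * suc p′) (suc d)) ⟩
    + (suc ∣ n ∣ * suc p′ * suc d)     ≡⟨ ℤ.pos-* (suc ∣ n ∣ * suc p′) (suc d) ⟩
    + S ℤ.* + suc d                    ∎)
    where
    open ℤ.≤-Reasoning
    i≤+∣i∣ : ∀ i → i ℤ.≤ + ∣ i ∣
    i≤+∣i∣ (+ _)       = ℤ.≤-refl
    i≤+∣i∣ (ℤ.-[1+ _ ]) = ℤ.-≤+

decompose : ∀ {p} → 1 < p → ∀ n → 0 < n → ∃[ a ] ∃[ m ] n ≡ p ^ a * m × ¬ (p ℕᵈ.∣ m)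
decompose {p} 1<p = <-rec (λ n → 0 < n → ∃[ a ] ∃[ m ] n ≡ p ^ a * m × ¬ (p ℕᵈ.∣ m)) λ n rec 0<n → split n rec 0<n
  where
  split : ∀ n → (∀ {m} → m < n → 0 < m → ∃[ a ] ∃[ m′ ] m ≡ p ^ a * m′ × ¬ (p ℕᵈ.∣ m′)) →
    0 < n → ∃[ a ] ∃[ m ] n ≡ p ^ a * m × ¬ (p ℕᵈ.∣ m)
  split n rec 0<n with p ℕᵈ.∣? n
  ... | no p∤n = 0 , n , sym (ℕ.*-identityˡ n) , p∤n
  ... | yes (ℕᵈ.divides zero refl) = contradiction 0<n λ ()
  ... | yes (ℕᵈ.divides n′@(suc _) refl) with a , m , eq , p∤m ← rec (ℕ.m<m*n n′ p 1<p) (s≤s z≤n) =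
    suc a , m , trans (trans (cong (_* p) eq) (ℕ.*-comm _ p)) (sym (ℕ.*-assoc p (p ^ a) m)) , p∤m

module _ {m p : ℕ} (pp : Prime p) (p∤m : ¬ (p ℕᵈ.∣ m)) (1<m : 1 < m) where

  instance
    p≢0 : NonZero p
    p≢0 = prime⇒nonZero pp

  1≤m^k%p^f : ∀ k f → 1 ≤ f → 1 ≤ (m ^ k % p ^ f) {{ℕ.m^n≢0 p f}}
  1≤m^k%p^f k (suc f) _ = ℕ.n≢0⇒n>0 λ eq →
    p∤m^n pp p∤m k (ℕᵈ.∣-trans (ℕᵈ.m∣m*n (p ^ f)) (ℕᵈ.m%n≡0⇒n∣m (m ^ k) (p ^ suc f) {{ℕ.m^n≢0 p (suc f)}} eq))

  record Growth (S D : ℕ) .{{_ : NonZero D}} : Set where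
    constructor growth
    field
      K       : ℕ
      S/p≤  : ∀ k → K ≤ k → + S ℚ./ p ℚ.≤ partialSum m p pp k (k / D)

  -- The first k / D′ terms contribute S/p by hypothesis, and a nonzero digit in the window from k /
  -- D′ to k / D adds 1/p. The arbitrary D in `Growth` leaves room for the next window.
  growth-suc : ∀ {S D D′ K} .{{_ : NonZero D}} .{{_ : NonZero D′}} →
    -- The threshold combines those of the gap bound and of the hypothesis with k ≥ D, which makes k
    -- / D positive.
    GapBound p m (2 * D) D′ K → Growth S D′ → Growth (suc S) D
  growth-suc {S} {D} {D′} {K₁} gap (growth K₂ S≤) = growth (K₁ + (K₂ + D)) step
    where
    step : ∀ k → K₁ + (K₂ + D) ≤ k → + suc S ℚ./ p ℚ.≤ partialSum m p pp k (k / D)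
    step k K≤k = Sum.[ digit , (λ small → contradiction p^f∣ (gap f f′ (ℕ.m+n≤o⇒m≤o K₁ K≤k) (1≤m^k%p^f k f 1≤f) small (m/n*n≤m k D′) k≤2Df)) ]
      (digit-in-window (m ^ k) p f′ f)
      where
      f f′ : ℕ
      f  = k / D
      f′ = k / D′
      K₂≤k : K₂ ≤ k
      K₂≤k = ℕ.m+n≤o⇒m≤o K₂ (ℕ.m+n≤o⇒n≤o K₁ K≤k)
      1≤f : 1 ≤ f
      1≤f = m≥n⇒m/n>0 (ℕ.m+n≤o⇒n≤o K₂ (ℕ.m+n≤o⇒n≤o K₁ K≤k))
      p^f∣ : + (p ^ f) ∣ + (m ^ k) ℤ.- + (m ^ k % p ^ f) {{ℕ.m^n≢0 p f}}
      p^f∣ = d∣N-N%d (m ^ k) (p ^ f) {{ℕ.m^n≢0 p f}}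
      regroup : ∀ f D → f * D + f * D ≡ 2 * D * f
      regroup = ℕ-solve-∀
      -- Rounding k / D down loses at most a factor 2, hence the gap bound for 2 D.
      k≤2Df : k ≤ 2 * D * f
      k≤2Df = begin
        k                ≡⟨ m≡m%n+[m/n]*n k D ⟩
        k % D + f * D    ≤⟨ ℕ.+-monoˡ-≤ (f * D) (ℕ.<⇒≤ (m%n<n k D)) ⟩
        D + f * D        ≤⟨ ℕ.+-monoˡ-≤ (f * D) (ℕ.m≤n*m D f {{>-nonZero 1≤f}}) ⟩
        f * D + f * D    ≡⟨ regroup f D ⟩
        2 * D * f        ∎
        where open ℕ.≤-Reasoning
      digit : (∃[ ν ] f′ ≤ ν × ν < f × p ^ ν ≤ (m ^ k % p ^ suc ν) {{ℕ.m^n≢0 p (suc ν)}}) →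
        + suc S ℚ./ p ℚ.≤ partialSum m p pp k f
      digit (ν , f′≤ν , ν<f , p^ν≤) = begin
        + suc S ℚ./ p                                                ≡⟨ +1/ S p ⟨
        -- Digit ν shows in term ν + 1, which is not among the first f′ terms because f′ ≤ ν.
        + S ℚ./ p ℚ.+ 1ℤ ℚ./ p                                       ≤⟨ ℚ.+-mono-≤ (S≤ k K₂≤k) (1/p≤frac (m ^ k) p ν {{p≢0}} {{ℕ.m^n≢0 p (suc ν)}} p^ν≤) ⟩
        partialSum m p pp k f′ ℚ.+ fracTerm m p pp k (suc ν)         ≤⟨ ℚ.+-monoˡ-≤ (fracTerm m p pp k (suc ν)) (partialSum-mono m p pp k f′≤ν) ⟩
        partialSum m p pp k (suc ν)                                  ≤⟨ partialSum-mono m p pp k ν<f ⟩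
        partialSum m p pp k f                                        ∎
        where open ℚ.≤-Reasoning

  partialSum-growth : ∀ S D .{{_ : NonZero D}} → Growth S D
  partialSum-growth zero    D = growth 0 λ k _ →
    subst (ℚ._≤ partialSum m p pp k (k / D)) (sym (ℚ.0/n≡0 p)) (0≤partialSum m p pp k (k / D))
  partialSum-growth (suc S) D = next (gap-bound pp p∤m 1<m (2 * D) (ℕ.*-mono-≤ {1} {2} (s≤s z≤n) (>-nonZero⁻¹ D)))
    where
    next : (∃[ D′ ] ∃[ K ] 1 ≤ D′ × GapBound p m (2 * D) D′ K) → Growth (suc S) D
    next (D′ , K , 1≤D′ , gap) = growth-suc {{_}} {{>-nonZero 1≤D′}} gap (partialSum-growth S D′ {{>-nonZero 1≤D′}})

theorem3 : (n p : ℕ) → 1 < n → (pp : Prime p) → ¬ (∃[ j ] n ≡ p ^ j) →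
    (M : ℚ) → ∃[ K ] ((k : ℕ) → K ≤ k → ∃[ V ] (M <ℚ partialSum n p pp k V))
theorem3 n p 1<n pp notPower M =
  diverges (decompose (nonTrivial⇒n>1 p {{prime⇒nonTrivial pp}}) n (ℕ.<⇒≤ 1<n)) (archimedean p {{prime⇒nonZero pp}} M)
  where
  diverges : (∃[ a ] ∃[ m ] n ≡ p ^ a * m × ¬ (p ℕᵈ.∣ m)) → (∃[ S ] M <ℚ (+ S ℚ./ p) {{prime⇒nonZero pp}}) →
    ∃[ K ] ((k : ℕ) → K ≤ k → ∃[ V ] (M <ℚ partialSum n p pp k V))
  diverges (a , 0 , _ , p∤0) _ = contradiction (p ℕᵈ.∣0) p∤0
  -- For m = 1 the number n would be a power of p.
  diverges (a , 1 , n≡ , _)  _ = contradiction (a , trans n≡ (ℕ.*-identityʳ (p ^ a))) notPower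
  -- The growth statement for D = 1 covers the first k terms for m, which reappear for n after a k
  -- further terms.
  diverges (a , m@(suc (suc _)) , refl , p∤m) (S , M<S/p) = K , λ k K≤k → a * k + k / 1 ,
    ℚ.<-≤-trans M<S/p (ℚ.≤-trans (S/p≤ k K≤k) (partialSum-p^a*m a m p pp k (k / 1)))
    where open Growth (partialSum-growth pp p∤m (s≤s (s≤s z≤n)) S 1)
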